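{- Let $k$ be a positive integer, let $G$ be a balanced bipartite graph of order $2n$ with $n \ge 12k-9$, and let $M$ be a perfect matching of $G$. If $\sigma_{1,1}(G)\ge n+2$, then $G$ contains $k$ pairwise vertex-disjoint $M$-cycles, each of length $6$ or $8$.
   Context: Graphs are finite and simple. A balanced bipartite graph has partite sets $X,Y$ with $|X|=|Y|$. $\sigma_{1,1}(G)=\min\{d_G(x)+d_G(y): x\in X, y\in Y, xy\notin E(G)\}$ if $G$ is not complete bipartite and $+\infty$ otherwise. For a matching $M$ of $G$, an $M$-cycle is a cycle $C$ of $G$ with $|E(C)\cap M| = |C|/2$, i.e., a cycle whose edges alternate between $M$ and $E(G)\setminus M$. -}

module Defs where

open import Data.Nat using (ℕ; zero; suc; _+_; _≤_)
open import Data.Nat.DivMod using (_mod_)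
open import Data.Fin using (Fin; toℕ)
open import Data.Bool using (Bool; true; false)
open import Data.List using (List; map; allFin)
open import Data.Nat.ListAction using (sum)
open import Data.Product using (Σ; _×_; ∃)
open import Data.Sum using (_⊎_)
open import Relation.Binary.PropositionalEquality using (_≡_; _≢_)
open import Relation.Nullary using (¬_)

-- A balanced bipartite (finite, simple) graph with partite sets
-- X = Fin n and Y = Fin n, given by its bipartite adjacency relation:
-- adj x y ≡ true  iff  xy is an edge (x ∈ X, y ∈ Y).
BipGraph : ℕ → Set
BipGraph n = Fin n → Fin n → Bool

b2n : Bool → ℕ
b2n true  = 1
b2n false = 0

degX : ∀ {n} → BipGraph n → Fin n → ℕ
degX {n} G x = sum (map (λ y → b2n (G x y)) (allFin n))

degY : ∀ {n} → BipGraph n → Fin n → ℕ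
degY {n} G y = sum (map (λ x → b2n (G x y)) (allFin n))

-- σ_{1,1}(G) ≥ s : every nonadjacent pair x ∈ X, y ∈ Y has degree sum ≥ s
-- (vacuous when G is complete bipartite, matching σ = +∞).
σ₁₁≥ : ∀ {n} → BipGraph n → ℕ → Set
σ₁₁≥ {n} G s = (x y : Fin n) → G x y ≡ false → s ≤ degX G x + degY G y

IsPerfectMatching : ∀ {n} → BipGraph n → (Fin n → Fin n → Bool) → Set
IsPerfectMatching {n} G M =
  ((x y : Fin n) → M x y ≡ true → G x y ≡ true)
  × ((x : Fin n) → Σ (Fin n) λ y → M x y ≡ true × ((y' : Fin n) → M x y' ≡ true → y' ≡ y))
  × ((y : Fin n) → Σ (Fin n) λ x → M x y ≡ true × ((x' : Fin n) → M x' y ≡ true → x' ≡ x))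

Injective : ∀ {m n} → (Fin m → Fin n) → Set
Injective {m} f = (i j : Fin m) → f i ≡ f j → i ≡ j

next : ∀ {m} → Fin (suc m) → Fin (suc m)
next {m} i = suc (toℕ i) mod (suc m)

-- A cycle of length 2(suc m) in a bipartite graph on X ∪ Y:
-- x₀ y₀ x₁ y₁ … x_m y_m x₀ with distinct x's, distinct y's,
-- edges x_i y_i and y_i x_{i+1} (indices mod m+1).
record Cycle {n : ℕ} (G : BipGraph n) (m : ℕ) : Set where
  field
    xs : Fin (suc m) → Fin n
    ys : Fin (suc m) → Fin n
    xs-inj : Injective xs
    ys-inj : Injective ys
    edge₁ : (i : Fin (suc m)) → G (xs i) (ys i) ≡ true
    edge₂ : (i : Fin (suc m)) → G (xs (next i)) (ys i) ≡ true
open Cycle public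

mEdges : ∀ {n} {G : BipGraph n} {m} → (Fin n → Fin n → Bool) → Cycle G m → ℕ
mEdges {m = m} M C =
  sum (map (λ i → b2n (M (xs C i) (ys C i)) + b2n (M (xs C (next i)) (ys C i)))
           (allFin (suc m)))

-- An M-cycle: |E(C) ∩ M| = |C|/2 = suc m
IsMCycle : ∀ {n} {G : BipGraph n} {m} → (Fin n → Fin n → Bool) → Cycle G m → Set
IsMCycle {m = m} M C = mEdges M C ≡ suc m

Disjoint : ∀ {n} {G : BipGraph n} {m m'} → Cycle G m → Cycle G m' → Set
Disjoint C D = (∀ i j → xs C i ≢ xs D j) × (∀ i j → ys C i ≢ ys D j)

-- An M-cycle of length 6 or 8 (half-length 3 or 4, i.e. m = 2 or m = 3)
record MCycle68 {n : ℕ} (G : BipGraph n) (M : Fin n → Fin n → Bool) : Set where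
  field
    half : ℕ
    half68 : half ≡ 2 ⊎ half ≡ 3
    cyc : Cycle G half
    isM : IsMCycle M cyc
open MCycle68 public

-- Contracting the perfect matching turns G into a digraph on n vertices, with an
-- arc u → v when the partner of u is adjacent to v; an M-cycle of length 6 or 8
-- becomes a directed triangle or 4-cycle, and the degree condition says that
-- |N⁺[u]| + |N⁻[v]| ≥ n + 2 whenever u ↛ v.
--
-- Suppose K disjoint short cycles are given, S is their vertex set, s = |S| ≤ 4K, and
-- the remaining vertices R, |R| = h ≥ n − s, span no short cycle.  Call a path z → w
-- or z → x → w of R with w ↛ z a link: a vertex c of S with w → c → z closes it to a
-- short cycle.  If w and z are joined to R with |N⁺[w]| + |N⁻[z]| ≤ h + 2 − r, they
-- send s + r arcs w → c, c → z to S.  Because R has no short cycle, links with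
-- r about h/5 exist, even outside two previously chosen links, and since
-- h ≥ 12K + 3 − s, three disjoint ones (two if K = 1) have total excess more than s.
-- Then on some cycle C these t links are closed more than |C| ≥ t times, so two of
-- them are closed by different vertices of C, and C can be traded for two cycles.
module Submission where

open import Defs
import Algebra.Solver.CommutativeMonoid as CommutativeMonoidSolver
open import Data.Bool using (Bool; true; false; _∧_)
import Data.Bool.Properties as Bool
open import Data.Empty using (⊥; ⊥-elim)
open import Data.Fin using (Fin; zero; suc)
import Data.Fin as Fin
open import Data.List using (List; []; _∷_; _++_; length; map; concat; filter; lookup; allFin)
open import Data.List.Properties
  using (length-++; length-map; length-tabulate; map-cong; map-∘; ++-identityʳ)
open import Data.List.Membership.Propositional using (_∈_; find; lose)
open import Data.List.Membership.Propositional.Properties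
  using (∈-∃++; ∈-++⁺ˡ; ∈-++⁺ʳ; ∈-filter⁺; ∈-filter⁻; ∈-lookup; ∈-allFin)
open import Data.List.Relation.Binary.Permutation.Propositional
  using (_↭_; ↭-refl; ↭-sym; ↭-trans; ↭-prep; ↭-reflexive; ↭⇒↭ₛ; module PermutationReasoning)
open import Data.List.Relation.Binary.Permutation.Propositional.Properties
  using (∈-resp-↭; All-resp-↭; shift; shifts; map⁺; ↭-length; ++⁺; ++⁺ˡ; ++⁺ʳ; ++-commutativeMonoid)
open import Data.List.Relation.Binary.Subset.Propositional using (_⊆_)
open import Data.List.Relation.Unary.All as All using (All; []; _∷_)
open import Data.List.Relation.Unary.AllPairs using ([]; _∷_)
open import Data.List.Relation.Unary.Any using (Any; here; there; any?)
open import Data.List.Relation.Unary.Any.Properties using (¬Any[])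
open import Data.List.Relation.Unary.Unique.Propositional using (Unique)
import Data.List.Relation.Unary.Unique.Propositional.Properties as Unique
open import Data.Nat using (ℕ; zero; suc; _+_; _*_; _≤_; _<_; z≤n; s≤s; _≤?_; _<?_)
open import Data.Nat.DivMod using (_/_; m≡m%n+[m/n]*n; m%n<n; m/n*n≤m)
open import Data.Nat.ListAction using (sum)
open import Data.Nat.ListAction.Properties using (sum-↭)
open import Data.Nat.Properties hiding (_≟_)
open import Data.Nat.Tactic.RingSolver using (solve-∀)
open import Data.Product using (Σ; ∃-syntax; _×_; _,_; proj₁; proj₂)
open import Data.Sum using (_⊎_; inj₁; inj₂; [_,_]′)
open import Function using (flip; id)
open import Level using (0ℓ)
open import Relation.Binary.Definitions using (DecidableEquality)
open import Relation.Binary.PropositionalEquality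
  using (_≡_; _≢_; refl; sym; trans; cong; cong₂; subst; subst₂; ≢-sym; setoid)
open import Relation.Nullary using (¬_; Dec; yes; no; does; contradiction)
open import Relation.Nullary.Decidable using (_×-dec_; ¬?)
open import Relation.Unary using (Pred; Decidable)

-- Sums of natural numbers over lists.

private variable
  A B : Set

∑ : (A → ℕ) → List A → ℕ
∑ f xs = sum (map f xs)

∑-++ : (f : A → ℕ) (xs ys : List A) → ∑ f (xs ++ ys) ≡ ∑ f xs + ∑ f ys
∑-++ f [] ys = refl
∑-++ f (x ∷ xs) ys = trans (cong (f x +_) (∑-++ f xs ys)) (sym (+-assoc (f x) _ _))

∑-↭ : (f : A → ℕ) {xs ys : List A} → xs ↭ ys → ∑ f xs ≡ ∑ f ys
∑-↭ f p = sum-↭ (map⁺ f p)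

∑-+ : (f g : A → ℕ) (xs : List A) → ∑ (λ x → f x + g x) xs ≡ ∑ f xs + ∑ g xs
∑-+ f g [] = refl
∑-+ f g (x ∷ xs) rewrite ∑-+ f g xs = lem (f x) (g x) (∑ f xs) (∑ g xs)
  where
  lem : ∀ a b c d → a + b + (c + d) ≡ a + c + (b + d)
  lem = solve-∀

∑-const : (c : ℕ) (xs : List A) → ∑ (λ _ → c) xs ≡ length xs * c
∑-const c [] = refl
∑-const c (x ∷ xs) = cong (c +_) (∑-const c xs)

∑-mono : {f g : A → ℕ} (xs : List A) → (∀ x → x ∈ xs → f x ≤ g x) → ∑ f xs ≤ ∑ g xs
∑-mono [] h = z≤n
∑-mono (x ∷ xs) h = +-mono-≤ (h x (here refl)) (∑-mono xs λ y y∈ → h y (there y∈))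

∑-swap : (f : A → B → ℕ) (xs : List A) (ys : List B) →
  ∑ (λ x → ∑ (f x) ys) xs ≡ ∑ (λ y → ∑ (λ x → f x y) xs) ys
∑-swap f [] ys = sym (trans (∑-const 0 ys) (*-zeroʳ (length ys)))
∑-swap f (x ∷ xs) ys rewrite ∑-swap f xs ys = sym (∑-+ (f x) _ ys)

-- The pigeonhole principle behind every choice of a vertex below: a constant `g` gives an averaging
-- argument, and a sum of indicators as `g` gives a vertex that avoids prescribed ones.
∑-exceeds : (f g : A → ℕ) (xs : List A) → ∑ g xs < ∑ f xs → ∃[ x ] x ∈ xs × g x < f x
∑-exceeds f g xs lt with any? (λ x → g x <? f x) xs
... | yes p = find p
... | no ¬p = contradiction (<-≤-trans lt (∑-mono xs λ x x∈ → ≮⇒≥ λ q → ¬p (lose x∈ q))) (<-irrefl refl)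

b2n≤1 : ∀ b → b2n b ≤ 1
b2n≤1 true = ≤-refl
b2n≤1 false = z≤n

exclusive : ∀ b c → (b ≡ true → c ≡ true → ⊥) → b2n b + b2n c ≤ 1
exclusive true true h = ⊥-elim (h refl refl)
exclusive true false h = ≤-refl
exclusive false c h = b2n≤1 c

-- Permutations and duplicate-free lists.

Unique-resp-↭ : {xs ys : List A} → xs ↭ ys → Unique xs → Unique ys
Unique-resp-↭ p = Permutation.Unique-resp-↭ (↭⇒↭ₛ p)
  where
  import Data.List.Relation.Binary.Permutation.Setoid.Properties (setoid _) as Permutation

unique-split : {x y : A} (xs : List A) {ys : List A} → Unique (xs ++ ys) → x ∈ xs → y ∈ ys → x ≢ y
unique-split (x ∷ xs) (d ∷ u) (here refl) y∈ = All.lookup d (∈-++⁺ʳ xs y∈)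
unique-split (x ∷ xs) (d ∷ u) (there x∈) y∈ = unique-split xs u x∈ y∈

unique-++ˡ : (xs : List A) {ys : List A} → Unique (xs ++ ys) → Unique xs
unique-++ˡ [] u = []
unique-++ˡ (x ∷ xs) (d ∷ u) = All.tabulate (λ y∈ → All.lookup d (∈-++⁺ˡ y∈)) ∷ unique-++ˡ xs u

unique-++ʳ : (xs : List A) {ys : List A} → Unique (xs ++ ys) → Unique ys
unique-++ʳ [] u = u
unique-++ʳ (x ∷ xs) (_ ∷ u) = unique-++ʳ xs u

split-∈ : {x : A} {xs : List A} → x ∈ xs → ∃[ ys ] xs ↭ x ∷ ys
split-∈ {x = x} x∈ with ys , zs , refl ← ∈-∃++ x∈ = ys ++ zs , shift x ys zs

∈-tail : {x y : A} {ys : List A} → y ≢ x → y ∈ x ∷ ys → y ∈ ys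
∈-tail ne (here eq) = contradiction eq ne
∈-tail ne (there y∈) = y∈

split-⊆ : {xs ys : List A} → Unique xs → xs ⊆ ys → ∃[ zs ] ys ↭ xs ++ zs
split-⊆ {ys = ys} [] sub = ys , ↭-refl
split-⊆ {xs = x ∷ xs} (d ∷ u) sub
  with ys′ , p ← split-∈ (sub (here refl))
  with zs , q ← split-⊆ u (λ y∈ → ∈-tail (λ { refl → All.lookup d y∈ refl }) (∈-resp-↭ p (sub (there y∈))))
  = zs , ↭-trans p (↭-prep x q)

concat-↭ : {xss yss : List (List A)} → xss ↭ yss → concat xss ↭ concat yss
concat-↭ _↭_.refl = ↭-refl
concat-↭ (_↭_.prep xs p) = ++⁺ˡ xs (concat-↭ p)
concat-↭ {xss = xs ∷ ys ∷ xss} (_↭_.swap xs ys p) = ↭-trans (shifts xs ys) (++⁺ˡ ys (++⁺ˡ xs (concat-↭ p)))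
concat-↭ (_↭_.trans p q) = ↭-trans (concat-↭ p) (concat-↭ q)

-- Indicators, counting and linear arithmetic.

module Indicator {V : Set} (_≟_ : DecidableEquality V) where

  δ : V → V → ℕ
  δ x y = b2n (does (x ≟ y))

  δ-refl : ∀ x → δ x x ≡ 1
  δ-refl x with x ≟ x
  ... | yes _ = refl
  ... | no ¬p = contradiction refl ¬p

  ∑δ≤1 : ∀ x {xs} → Unique xs → ∑ (δ x) xs ≤ 1
  ∑δ≤1 x [] = z≤n
  ∑δ≤1 x {y ∷ ys} (d ∷ u) with x ≟ y
  ... | no _ = ∑δ≤1 x u
  ... | yes refl = s≤s (≤-trans (∑-mono ys zero-δ) (≤-reflexive (trans (∑-const 0 ys) (*-zeroʳ (length ys)))))
    where
    zero-δ : ∀ z → z ∈ ys → δ x z ≤ 0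
    zero-δ z z∈ with x ≟ z
    ... | yes refl = ⊥-elim (All.lookup d z∈ refl)
    ... | no _ = z≤n

  1≤∑δ : ∀ {x xs} → x ∈ xs → 1 ≤ ∑ (δ x) xs
  1≤∑δ {x} (here refl) rewrite δ-refl x = s≤s z≤n
  1≤∑δ (there x∈) = ≤-trans (1≤∑δ x∈) (m≤n+m _ _)

∑-filter : {A : Set} {P : Pred A 0ℓ} (P? : Decidable P) (f : A → ℕ) (xs : List A) →
  ∑ f (filter P? xs) ≡ ∑ (λ x → b2n (does (P? x)) * f x) xs
∑-filter P? f [] = refl
∑-filter P? f (x ∷ xs) with does (P? x)
... | true = cong₂ _+_ (sym (+-identityʳ (f x))) (∑-filter P? f xs)
... | false = ∑-filter P? f xs

-- Linear arithmetic: the hypotheses are added up to a ≤ b, and the ring solver shows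
-- that a exceeds b by c + 1.
linear-⊥ : ∀ {a b} c → a ≤ b → a ≡ suc (c + b) → ⊥
linear-⊥ {b = b} c le refl = <-irrefl refl (≤-trans (s≤s (m≤n+m b c)) le)

∑-1 : {A : Set} (xs : List A) → ∑ (λ _ → 1) xs ≡ length xs
∑-1 xs = trans (∑-const 1 xs) (*-identityʳ _)

∑-exclusive : {A : Set} (p q : A → Bool) (xs : List A) →
  (∀ x → x ∈ xs → p x ≡ true → q x ≡ true → ⊥) →
  ∑ (λ x → b2n (p x)) xs + ∑ (λ x → b2n (q x)) xs ≤ length xs
∑-exclusive p q xs disj = begin
  ∑ (λ x → b2n (p x)) xs + ∑ (λ x → b2n (q x)) xs ≡⟨ ∑-+ (λ x → b2n (p x)) (λ x → b2n (q x)) xs ⟨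
  ∑ (λ x → b2n (p x) + b2n (q x)) xs ≤⟨ ∑-mono xs (λ x x∈ → exclusive (p x) (q x) (disj x x∈)) ⟩
  ∑ (λ _ → 1) xs ≡⟨ ∑-1 xs ⟩
  length xs ∎
  where open ≤-Reasoning

-- Exhaustive search for tuples in a list.

search : {A : Set} (R : A → Set) → (∀ x → Dec (R x)) → (xs : List A) →
  (∃[ x ] x ∈ xs × R x) ⊎ (∀ {x} → x ∈ xs → ¬ R x)
search R R? xs with any? R? xs
... | yes p = inj₁ (find p)
... | no ¬p = inj₂ λ x∈ r → ¬p (lose x∈ r)

search₂ : {A : Set} (R : A → A → Set) → (∀ x y → Dec (R x y)) → (xs : List A) →
  (∃[ x ] ∃[ y ] x ∈ xs × y ∈ xs × R x y) ⊎ (∀ {x y} → x ∈ xs → y ∈ xs → ¬ R x y)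
search₂ R R? xs with search (λ x → Any (R x) xs) (λ x → any? (R? x) xs) xs
... | inj₁ (x , x∈ , p) = let y , y∈ , r = find p in inj₁ (x , y , x∈ , y∈ , r)
... | inj₂ none = inj₂ λ x∈ y∈ r → none x∈ (lose y∈ r)

search₃ : {A : Set} (R : A → A → A → Set) → (∀ x y z → Dec (R x y z)) → (xs : List A) →
  (∃[ x ] ∃[ y ] ∃[ z ] x ∈ xs × y ∈ xs × z ∈ xs × R x y z)
  ⊎ (∀ {x y z} → x ∈ xs → y ∈ xs → z ∈ xs → ¬ R x y z)
search₃ R R? xs
  with search₂ (λ x y → Any (R x y) xs) (λ x y → any? (R? x y) xs) xs
... | inj₁ (x , y , x∈ , y∈ , p) = let z , z∈ , r = find p in inj₁ (x , y , z , x∈ , y∈ , z∈ , r)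
... | inj₂ none = inj₂ λ x∈ y∈ z∈ r → none x∈ y∈ (lose z∈ r)

search₄ : {A : Set} (R : A → A → A → A → Set) → (∀ x y z w → Dec (R x y z w)) → (xs : List A) →
  (∃[ x ] ∃[ y ] ∃[ z ] ∃[ w ] x ∈ xs × y ∈ xs × z ∈ xs × w ∈ xs × R x y z w)
  ⊎ (∀ {x y z w} → x ∈ xs → y ∈ xs → z ∈ xs → w ∈ xs → ¬ R x y z w)
search₄ R R? xs
  with search₃ (λ x y z → Any (R x y z) xs) (λ x y z → any? (R? x y z) xs) xs
... | inj₁ (x , y , z , x∈ , y∈ , z∈ , p) =
  let w , w∈ , r = find p in inj₁ (x , y , z , w , x∈ , y∈ , z∈ , w∈ , r)
... | inj₂ none = inj₂ λ x∈ y∈ z∈ w∈ r → none x∈ y∈ z∈ (lose w∈ r)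

-- Digraphs without directed triangles and 4-cycles.

module Digraph {V : Set} (_≟_ : DecidableEquality V) where
  open Indicator _≟_ public

  Relation : Set
  Relation = V → V → Bool

  out : Relation → V → List V → ℕ
  out E u = ∑ (λ y → b2n (E u y))

  -- Distinctness is demanded because the digraph of interest has a loop at every vertex.
  NoTri : Relation → List V → Set
  NoTri E H = ∀ {a b c} → a ∈ H → b ∈ H → c ∈ H → a ≢ b → a ≢ c → b ≢ c →
    E a b ≡ true → E b c ≡ true → E c a ≡ true → ⊥

  NoQuad : Relation → List V → Set
  NoQuad E H = ∀ {a b c d} → a ∈ H → b ∈ H → c ∈ H → d ∈ H →
    a ≢ b → a ≢ c → a ≢ d → b ≢ c → b ≢ d → c ≢ d →
    E a b ≡ true → E b c ≡ true → E c d ≡ true → E d a ≡ true → ⊥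

  true≢false : ∀ {b : Bool} → b ≡ true → b ≡ false → ⊥
  true≢false refl ()

  δ<⇒ : ∀ {a b c} → δ a b < b2n c → a ≢ b × c ≡ true
  δ<⇒ {a} {b} {c} lt with a ≟ b | c
  ... | yes _ | true = contradiction lt (<-irrefl refl)
  ... | yes _ | false = contradiction lt λ ()
  ... | no ne | true = ne , refl
  ... | no ne | false = contradiction lt λ ()

  -- Otherwise, by double counting, some a has more than |L| / 2 in-neighbours; for an
  -- arc a → b, the closed neighbourhoods N⁺[b] and N⁻[a] meet at most in a and b.
  triangle-free-low : ∀ E L → Unique L → NoTri E L →
    (∀ a → a ∈ L → length L + 3 ≤ out E a L + out E a L) → L ≡ []
  triangle-free-low E [] u nt high = refl
  triangle-free-low E L@(x ∷ xs) u nt high = ⊥-elim bad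
    where
    l = length L
    inn = λ a → out (flip E) a L
    total : l * (l + 3) ≤ ∑ (λ a → inn a + inn a) L
    total = begin
      l * (l + 3) ≡⟨ ∑-const (l + 3) L ⟨
      ∑ (λ _ → l + 3) L ≤⟨ ∑-mono L high ⟩
      ∑ (λ a → out E a L + out E a L) L ≡⟨ ∑-+ (λ a → out E a L) (λ a → out E a L) L ⟩
      ∑ (λ a → out E a L) L + ∑ (λ a → out E a L) L
        ≡⟨ cong₂ _+_ (∑-swap (λ a b → b2n (E a b)) L L) (∑-swap (λ a b → b2n (E a b)) L L) ⟩
      ∑ inn L + ∑ inn L ≡⟨ ∑-+ inn inn L ⟨
      ∑ (λ a → inn a + inn a) L ∎
      where open ≤-Reasoning
    -- Strict because `L` is nonempty, so that `l` is nonzero.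
    exceeds : ∑ (λ _ → l + 2) L < ∑ (λ a → inn a + inn a) L
    exceeds rewrite ∑-const (l + 2) L = ≤-trans (*-monoʳ-< l (+-monoʳ-< l ≤-refl)) total
    lem : ∀ k o → suc k + 3 + (o + o) ≡ suc ((k + 1) + (o + o + (1 + 1)))
    lem = solve-∀
    lem₂ : ∀ l o i → l + 3 + suc (l + 2) + (o + i + (o + i)) ≡ suc (1 + (o + o + (i + i) + (l + 1 + 1 + (l + 1 + 1))))
    lem₂ = solve-∀
    -- A common vertex y of N⁺[b] and N⁻[a] other than `a` and `b` closes the triangle a → b → y →
    -- a.
    common-≤ : ∀ a b → a ∈ L → b ∈ L → a ≢ b → E a b ≡ true → out E b L + inn a ≤ l + 1 + 1
    common-≤ a b a∈ b∈ a≢b a→b = begin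
      out E b L + inn a ≡⟨ ∑-+ (λ y → b2n (E b y)) (λ y → b2n (E y a)) L ⟨
      ∑ (λ y → b2n (E b y) + b2n (E y a)) L ≤⟨ ∑-mono L pointwise ⟩
      ∑ (λ y → 1 + δ a y + δ b y) L ≡⟨ ∑-+ (λ y → 1 + δ a y) (δ b) L ⟩
      ∑ (λ y → 1 + δ a y) L + ∑ (δ b) L ≡⟨ cong (_+ ∑ (δ b) L) (∑-+ (λ _ → 1) (δ a) L) ⟩
      ∑ (λ _ → 1) L + ∑ (δ a) L + ∑ (δ b) L
        ≤⟨ +-mono-≤ (+-mono-≤ (≤-reflexive (∑-1 L)) (∑δ≤1 a u)) (∑δ≤1 b u) ⟩
      l + 1 + 1 ∎
      where
      open ≤-Reasoning
      pointwise : ∀ y → y ∈ L → b2n (E b y) + b2n (E y a) ≤ 1 + δ a y + δ b y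
      pointwise y y∈ with a ≟ y | b ≟ y
      ... | yes _ | d = ≤-trans (+-mono-≤ (b2n≤1 (E b y)) (b2n≤1 (E y a))) (s≤s (s≤s z≤n))
      ... | no _ | yes _ = +-mono-≤ (b2n≤1 (E b y)) (b2n≤1 (E y a))
      ... | no a≢y | no b≢y = exclusive (E b y) (E y a) (nt a∈ b∈ y∈ a≢b a≢y b≢y a→b)
    -- Since `l` is at least 1, `high` forces out-degree at least 2; one unit is set aside for a
    -- possible loop at `a`.
    successor : ∀ a → a ∈ L → ∃[ b ] b ∈ L × δ a b < b2n (E a b)
    successor a a∈ = ∑-exceeds (λ y → b2n (E a y)) (δ a) L
      (≤-<-trans (∑δ≤1 a u) (≰⇒> λ le → linear-⊥ (length xs + 1)
        (+-mono-≤ (high a a∈) (+-mono-≤ le le)) (lem (length xs) (out E a L))))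
    bad : ⊥
    bad with ∑-exceeds (λ a → inn a + inn a) (λ _ → l + 2) L exceeds
    ... | a , a∈ , ia with successor a a∈
    ... | b , b∈ , ab with δ<⇒ ab
    -- Twice |N⁺[b]| + |N⁻[a]| is at least 2(l + 3) by the choice of `a` and `b`, but at most 2(l +
    -- 2) by `common-≤`.
    ... | a≢b , a→b = linear-⊥ 1
      (+-mono-≤ (+-mono-≤ (high b b∈) ia)
        (+-mono-≤ (common-≤ a b a∈ b∈ a≢b a→b) (common-≤ a b a∈ b∈ a≢b a→b)))
      (lem₂ l (out E b L) (inn a))

  -- Every out-neighbour a of w ends a link z → w → a, so |N⁺[a]| is large; but N⁺[a] is
  -- disjoint from N⁻[z], so a has many out-neighbours inside N⁺[w].  By
  -- triangle-free-low this bounds the size of N⁺[w].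
  out-after-arc : ∀ E X Y {z w} r → Unique Y → (∀ v → E v v ≡ true) →
    NoTri E (X ++ Y) → NoQuad E (X ++ Y) →
    z ∈ Y → w ∈ Y → E z w ≡ true → E w z ≡ false → 3 ≤ r →
    (∀ a → a ∈ Y → w ≢ a → E w a ≡ true → E a z ≡ false →
      length X + length Y + 3 ≤ r + (out E a (X ++ Y) + out (flip E) z (X ++ Y))) →
    out E w Y + 3 ≤ r + r
  out-after-arc E X Y {z} {w} r u E-refl nt nq z∈ w∈ zw wz 3≤r link = ≮⇒≥ bad
    where
    H = X ++ Y
    inY : ∀ {y} → y ∈ Y → y ∈ H
    inY = ∈-++⁺ʳ X
    P? : Decidable (λ y → E w y ≡ true × w ≢ y)
    P? y = (E w y Bool.≟ true) ×-dec ¬? (w ≟ y)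
    N = filter P? Y
    z≢w : z ≢ w
    z≢w refl = true≢false zw wz

    N<out : length N + 1 ≤ out E w Y
    N<out = begin
      length N + 1 ≤⟨ +-mono-≤ (≤-reflexive (sym (∑-1 N))) (1≤∑δ w∈) ⟩
      ∑ (λ _ → 1) N + ∑ (δ w) Y ≡⟨ cong (_+ ∑ (δ w) Y) (∑-filter P? (λ _ → 1) Y) ⟩
      ∑ (λ y → b2n (does (P? y)) * 1) Y + ∑ (δ w) Y ≡⟨ ∑-+ (λ y → b2n (does (P? y)) * 1) (δ w) Y ⟨
      ∑ (λ y → b2n (does (P? y)) * 1 + δ w y) Y ≤⟨ ∑-mono Y pointwise ⟩
      out E w Y ∎
      where
      open ≤-Reasoning
      pointwise : ∀ y → y ∈ Y → b2n (does (P? y)) * 1 + δ w y ≤ b2n (E w y)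
      pointwise y y∈ with w ≟ y | E w y in eq
      ... | yes refl | true = ≤-refl
      ... | yes refl | false = ⊥-elim (true≢false (E-refl w) eq)
      ... | no _ | true = ≤-refl
      ... | no _ | false = ≤-refl

    module _ a (a∈ : a ∈ Y) (w≢a : w ≢ a) (wa : E w a ≡ true) where
      az : E a z ≢ true
      az e with z ≟ a
      ... | yes refl = true≢false wa wz
      ... | no z≢a = nt (inY z∈) (inY w∈) (inY a∈) z≢w z≢a w≢a zw wa e
      -- Such a `y` gives the 4-cycle z → w → a → y → z, or the arc a → z if `y` is `a` or `z`.
      through : ∀ y → y ∈ H → y ≢ w → E a y ≡ true → E y z ≡ true → ⊥
      through y y∈ y≢w ay yz with a ≟ y | y ≟ z
      ... | yes refl | _ = az yz
      ... | no _ | yes refl = az ay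
      ... | no a≢y | no y≢z =
        nq (inY z∈) (inY w∈) (inY a∈) y∈ z≢w (λ { refl → true≢false wa wz }) (≢-sym y≢z)
          w≢a (≢-sym y≢w) a≢y zw wa ay yz

      in-X : out E a X + out (flip E) z X ≤ length X
      in-X = ∑-exclusive (E a) (λ y → E y z) X λ y y∈ →
        λ ay yz →
        through y (∈-++⁺ˡ y∈) (λ { refl → true≢false yz wz }) ay yz

      -- N⁻[z] misses N⁺[a] by `through` and N⁺[w] by triangle-freeness. So a vertex is counted
      -- twice only in the intersection of N⁺[a] and N⁺[w], which lies in `N` apart from `w` itself.
      in-Y : out E a Y + out E w Y + out (flip E) z Y ≤ length Y + out E a N + 1
      in-Y = begin
        out E a Y + out E w Y + out (flip E) z Y
          ≡⟨ cong (_+ out (flip E) z Y) (∑-+ (λ y → b2n (E a y)) (λ y → b2n (E w y)) Y) ⟨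
        ∑ (λ y → b2n (E a y) + b2n (E w y)) Y + out (flip E) z Y
          ≡⟨ ∑-+ (λ y → b2n (E a y) + b2n (E w y)) (λ y → b2n (E y z)) Y ⟨
        ∑ (λ y → b2n (E a y) + b2n (E w y) + b2n (E y z)) Y ≤⟨ ∑-mono Y pointwise ⟩
        ∑ (λ y → 1 + b2n (does (P? y)) * b2n (E a y) + δ w y) Y
          ≡⟨ ∑-+ (λ y → 1 + b2n (does (P? y)) * b2n (E a y)) (δ w) Y ⟩
        ∑ (λ y → 1 + b2n (does (P? y)) * b2n (E a y)) Y + ∑ (δ w) Y
          ≡⟨ cong (_+ ∑ (δ w) Y) (∑-+ (λ _ → 1) (λ y → b2n (does (P? y)) * b2n (E a y)) Y) ⟩
        ∑ (λ _ → 1) Y + ∑ (λ y → b2n (does (P? y)) * b2n (E a y)) Y + ∑ (δ w) Y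
          ≤⟨ +-mono-≤ (≤-reflexive (cong₂ _+_ (∑-1 Y)
               (sym (∑-filter P? (λ y → b2n (E a y)) Y)))) (∑δ≤1 w u) ⟩
        length Y + out E a N + 1 ∎
        where
        open ≤-Reasoning
        pointwise : ∀ y → y ∈ Y → b2n (E a y) + b2n (E w y) + b2n (E y z)
          ≤ 1 + b2n (does (P? y)) * b2n (E a y) + δ w y
        pointwise y y∈ with w ≟ y
        ... | yes refl rewrite wz | E-refl w = ≤-trans (≤-reflexive (+-identityʳ _))
                (+-monoˡ-≤ 1 (b2n≤1 (E a w)))
        ... | no w≢y with E w y in wy | E y z in yz | E a y in ay
        ... | false | false | false = z≤n
        ... | false | false | true = s≤s z≤n
        ... | false | true | false = s≤s z≤n
        ... | false | true | true = ⊥-elim (through y (inY y∈) (≢-sym w≢y) ay yz)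
        ... | true | false | false = s≤s z≤n
        ... | true | false | true = ≤-refl
        ... | true | true | false = ⊥-elim (nt (inY z∈) (inY w∈) (inY y∈) z≢w (λ { refl → true≢false wy wz }) w≢y zw wy yz)
        ... | true | true | true = ⊥-elim (through y (inY y∈) (≢-sym w≢y) ay yz)

      -- With d = `out E a N`, the bounds in `X` and `Y` turn `link` into |N⁺[w] ∩ Y| + 2 ≤ r + d.
      -- Doubling this and eliminating `r` by the assumption gives the claim.
      high : r + r < out E w Y + 3 → length N + 3 ≤ out E a N + out E a N
      high lt = ≮⇒≥ λ lt′ → linear-⊥ 0
        (+-mono-≤ (+-mono-≤ (+-mono-≤ in-X in-X) (+-mono-≤ in-Y in-Y))
          (+-mono-≤ (+-mono-≤ bound bound) (+-mono-≤ (+-mono-≤ lt lt′) N<out)))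
        (lem (out E a X) (out (flip E) z X) (length X) (out E a Y) (out E w Y) (out (flip E) z Y) (length Y) (out E a N) r (length N))
        where
        bound : length X + length Y + 3 ≤ r + ((out E a X + out E a Y) + (out (flip E) z X + out (flip E) z Y))
        bound = subst₂ (λ p q → length X + length Y + 3 ≤ r + (p + q))
          (∑-++ (λ y → b2n (E a y)) X Y) (∑-++ (λ y → b2n (E y z)) X Y) (link a a∈ w≢a wa (Bool.¬-not az))
        lem : ∀ aX zX x aY wY zY y d r N →
          aX + zX + (aX + zX) + (aY + wY + zY + (aY + wY + zY))
            + (x + y + 3 + (x + y + 3) + (suc (r + r) + suc (d + d) + (N + 1)))
          ≡ suc (x + x + (y + d + 1 + (y + d + 1))
            + (r + ((aX + aY) + (zX + zY)) + (r + ((aX + aY) + (zX + zY))) + (wY + 3 + (N + 3) + wY)))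
        lem = solve-∀

    -- By `triangle-free-low` the list `N` is empty, so only the loop at `w` is left and 2r < 4,
    -- against 3 ≤ r.
    bad : r + r < out E w Y + 3 → ⊥
    bad lt = linear-⊥ 2 (+-mono-≤ (+-mono-≤ 3≤r 3≤r) (+-mono-≤ lt small)) (lem r (out E w Y))
      where
      up : ∀ {a} → a ∈ N → a ∈ H
      up a∈ = inY (proj₁ (∈-filter⁻ P? {xs = Y} a∈))
      N≡[] : N ≡ []
      N≡[] = triangle-free-low E N (Unique.filter⁺ P? u)
        (λ a∈ b∈ c∈ → nt (up a∈) (up b∈) (up c∈))
        (λ a a∈ → let (a∈Y , wa , w≢a) = ∈-filter⁻ P? {xs = Y} a∈ in high a a∈Y w≢a wa lt)
      lem : ∀ r o → 3 + 3 + (suc (r + r) + o) ≡ suc (2 + (r + r + (o + 3 + 1)))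
      lem = solve-∀
      small : out E w Y ≤ 1
      small = ≤-trans (∑-mono Y pointwise) (∑δ≤1 w u)
        where
        pointwise : ∀ y → y ∈ Y → b2n (E w y) ≤ δ w y
        pointwise y y∈ with w ≟ y
        ... | yes _ = b2n≤1 (E w y)
        ... | no w≢y = ≤-reflexive (cong b2n (Bool.¬-not λ wy →
          ¬Any[] (subst (y ∈_) N≡[] (∈-filter⁺ P? y∈ (wy , w≢y)))))

  -- Each vertex to be avoided costs at most one unit of the count: first `x`, then `x` and the
  -- vertex already chosen.
  two-neighbours : ∀ E Y {x} → Unique Y → 3 ≤ out E x Y →
    ∃[ z ] ∃[ w ] z ∈ Y × w ∈ Y × x ≢ z × x ≢ w × z ≢ w × E x z ≡ true × E x w ≡ true
  two-neighbours E Y {x} u deg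
    with ∑-exceeds (λ y → b2n (E x y)) (δ x) Y (≤-<-trans (∑δ≤1 x u) (≤-trans (n≤1+n 2) deg))
  ... | z , z∈ , lt with δ<⇒ lt
  ... | x≢z , xz
    with ∑-exceeds (λ y → b2n (E x y)) (λ y → δ x y + δ z y) Y
           (≤-<-trans (≤-trans (≤-reflexive (∑-+ (δ x) (δ z) Y)) (+-mono-≤ (∑δ≤1 x u) (∑δ≤1 z u))) deg)
  ... | w , w∈ , lt′ with δ<⇒ (≤-<-trans (m≤m+n _ _) lt′) | δ<⇒ {z} (≤-<-trans (m≤n+m _ (δ x w)) lt′)
  ... | x≢w , xw | z≢w , _ = z , w , z∈ , w∈ , x≢z , x≢w , z≢w , xz , xw

  -- In the symmetric part Y the neighbours of x are pairwise nonadjacent, and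
  -- N⁺[w] and N⁻[z] meet only in x: so they leave out the other neighbours of x.
  out-of-centre : ∀ E X Y {x z w} r → Unique Y →
    NoTri E (X ++ Y) → NoQuad E (X ++ Y) →
    (∀ {u v} → u ∈ Y → v ∈ Y → E u v ≡ true → E v u ≡ true) →
    (∀ {y} → y ∈ X → y ≢ x) →
    x ∈ Y → z ∈ Y → w ∈ Y → x ≢ z → x ≢ w → z ≢ w → E x z ≡ true → E x w ≡ true →
    length X + length Y + 3 ≤ r + (out E w (X ++ Y) + out (flip E) z (X ++ Y)) →
    out E x Y ≤ r + 1 × out E w X + out (flip E) z X ≤ length X
  out-of-centre E X Y {x} {z} {w} r u nt nq symm x∉X x∈ z∈ w∈ x≢z x≢w z≢w xz xw link =
    (≮⇒≥ λ lt → linear-⊥ 0 (+-mono-≤ (+-mono-≤ in-X in-Y) (+-mono-≤ bound lt))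
      (lem (out E w X) (out (flip E) z X) (length X) (out E w Y) (out (flip E) z Y) (out E x Y) (length Y) r))
    , in-X
    where
    inY : ∀ {y} → y ∈ Y → y ∈ X ++ Y
    inY = ∈-++⁺ʳ X
    zx = symm x∈ z∈ xz
    wz : E w z ≢ true
    wz e = nt (inY x∈) (inY w∈) (inY z∈) x≢w x≢z (≢-sym z≢w) xw e zx
    -- Such a `y` gives the 4-cycle x → w → y → z → x, or the arc w → z if `y` is `w` or `z`.
    through : ∀ y → y ∈ X ++ Y → y ≢ x → E w y ≡ true → E y z ≡ true → ⊥
    through y y∈ y≢x wy yz with w ≟ y | y ≟ z
    ... | yes refl | _ = wz yz
    ... | no _ | yes refl = wz wy
    ... | no w≢y | no y≢z = nq (inY x∈) (inY w∈) y∈ (inY z∈) x≢w (≢-sym y≢x) x≢z w≢y (≢-sym z≢w) y≢z xw wy yz zx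

    in-X : out E w X + out (flip E) z X ≤ length X
    in-X = ∑-exclusive (E w) (λ y → E y z) X λ y y∈ → through y (∈-++⁺ˡ y∈) (x∉X y∈)

    -- A vertex other than `x`, `z` and `w` lies in at most one of N⁺[w], N⁻[z] and N⁺[x]. The
    -- vertex `x` may lie in all three, and `z` and `w` in two each, whence the surplus of 4.
    in-Y : out E w Y + out (flip E) z Y + out E x Y ≤ length Y + (1 + 1) + 1 + 1
    in-Y = begin
      out E w Y + out (flip E) z Y + out E x Y
        ≡⟨ cong (_+ out E x Y) (∑-+ (λ y → b2n (E w y)) (λ y → b2n (E y z)) Y) ⟨
      ∑ (λ y → b2n (E w y) + b2n (E y z)) Y + out E x Y
        ≡⟨ ∑-+ (λ y → b2n (E w y) + b2n (E y z)) (λ y → b2n (E x y)) Y ⟨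
      ∑ (λ y → b2n (E w y) + b2n (E y z) + b2n (E x y)) Y ≤⟨ ∑-mono Y pointwise ⟩
      ∑ (λ y → 1 + (δ x y + δ x y) + δ z y + δ w y) Y
        ≡⟨ ∑-+ (λ y → 1 + (δ x y + δ x y) + δ z y) (δ w) Y ⟩
      ∑ (λ y → 1 + (δ x y + δ x y) + δ z y) Y + ∑ (δ w) Y
        ≡⟨ cong (_+ ∑ (δ w) Y) (∑-+ (λ y → 1 + (δ x y + δ x y)) (δ z) Y) ⟩
      ∑ (λ y → 1 + (δ x y + δ x y)) Y + ∑ (δ z) Y + ∑ (δ w) Y
        ≡⟨ cong (λ s → s + ∑ (δ z) Y + ∑ (δ w) Y) (trans (∑-+ (λ _ → 1) (λ y → δ x y + δ x y) Y)
             (cong₂ _+_ (∑-1 Y) (∑-+ (δ x) (δ x) Y))) ⟩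
      length Y + (∑ (δ x) Y + ∑ (δ x) Y) + ∑ (δ z) Y + ∑ (δ w) Y
        ≤⟨ +-mono-≤ (+-mono-≤ (+-monoʳ-≤ (length Y) (+-mono-≤ (∑δ≤1 x u) (∑δ≤1 x u))) (∑δ≤1 z u)) (∑δ≤1 w u) ⟩
      length Y + (1 + 1) + 1 + 1 ∎
      where
      open ≤-Reasoning
      pointwise : ∀ y → y ∈ Y → b2n (E w y) + b2n (E y z) + b2n (E x y) ≤ 1 + (δ x y + δ x y) + δ z y + δ w y
      pointwise y y∈ with x ≟ y
      ... | yes refl = ≤-trans (+-mono-≤ (+-mono-≤ (b2n≤1 (E w y)) (b2n≤1 (E y z))) (b2n≤1 (E y y)))
                         (≤-trans (m≤m+n 3 (δ z y)) (m≤m+n _ (δ w y)))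
      ... | no x≢y with z ≟ y
      ... | yes refl rewrite Bool.¬-not wz = ≤-trans (+-mono-≤ (b2n≤1 (E y y)) (b2n≤1 (E x y))) (m≤m+n 2 (δ w y))
      ... | no z≢y with w ≟ y
      ... | yes refl rewrite Bool.¬-not wz | +-identityʳ (b2n (E y y)) = +-mono-≤ (b2n≤1 (E y y)) (b2n≤1 (E x y))
      ... | no w≢y with E w y in wy | E y z in yz | E x y in xy
      ... | true | true | _ = ⊥-elim (through y (inY y∈) (≢-sym x≢y) wy yz)
      ... | true | false | true = ⊥-elim (nt (inY x∈) (inY w∈) (inY y∈) x≢w x≢y w≢y xw wy (symm x∈ y∈ xy))
      ... | false | true | true = ⊥-elim (nt (inY x∈) (inY y∈) (inY z∈) x≢y x≢z (≢-sym z≢y) xy yz zx)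
      ... | true | false | false = s≤s z≤n
      ... | false | true | false = s≤s z≤n
      ... | false | false | true = s≤s z≤n
      ... | false | false | false = z≤n

    bound : length X + length Y + 3 ≤ r + ((out E w X + out E w Y) + (out (flip E) z X + out (flip E) z Y))
    bound = subst₂ (λ p q → length X + length Y + 3 ≤ r + (p + q))
      (∑-++ (λ y → b2n (E w y)) X Y) (∑-++ (λ y → b2n (E y z)) X Y) link
    lem : ∀ wX zX m wY zY xY y r → wX + zX + (wY + zY + xY) + (m + y + 3 + suc (r + 1))
      ≡ suc (0 + (m + (y + (1 + 1) + 1 + 1) + (r + ((wX + wY) + (zX + zY)) + xY)))
    lem = solve-∀

  -- The missing arc w → z is part of the data because the degree condition speaks only about such
  -- pairs.
  data IsLink (E : Relation) : List V → V → V → Set where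
    arc : ∀ {z w} → E z w ≡ true → E w z ≡ false → IsLink E (z ∷ w ∷ []) z w
    path : ∀ {z x w} → E z x ≡ true → E x w ≡ true → E w z ≡ false → IsLink E (z ∷ x ∷ w ∷ []) z w

  -- In a link p₁ → p₂ → p₃, arcs u → pᵢ and pᵢ₊₁ → u do not coexist.
  link-degree : ∀ E H {l z w u} → NoTri E H → IsLink E l z w → (∀ {y} → y ∈ l → y ∈ H) → Unique l →
    u ∈ H → (∀ {y} → y ∈ l → y ≢ u) → out E u l + out (flip E) u l ≤ 4
  link-degree E H {u = u} nt (arc {z} {w} _ _) l⊆H ul u∈ u∉ =
    +-mono-≤ (+-mono-≤ (b2n≤1 (E u z)) (+-monoˡ-≤ 0 (b2n≤1 (E u w))))
      (+-mono-≤ (b2n≤1 (E z u)) (+-monoˡ-≤ 0 (b2n≤1 (E w u))))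
  link-degree E H {u = u} nt (path {z} {x} {w} zx xw _) l⊆H ((z≢x ∷ _) ∷ (x≢w ∷ _) ∷ _) u∈ u∉ =
    subst (_≤ 4) (sym (lem (b2n (E u z)) (b2n (E u x)) (b2n (E u w)) (b2n (E z u)) (b2n (E x u)) (b2n (E w u))))
      (+-mono-≤ (+-mono-≤ (exclusive (E u z) (E x u) (no-tri (here refl) (there (here refl)) z≢x zx))
                          (exclusive (E u x) (E w u) (no-tri (there (here refl)) (there (there (here refl))) x≢w xw)))
                (+-mono-≤ (b2n≤1 (E u w)) (b2n≤1 (E z u))))
    where
    no-tri : ∀ {p q} → p ∈ z ∷ x ∷ w ∷ [] → q ∈ z ∷ x ∷ w ∷ [] → p ≢ q → E p q ≡ true →
      E u p ≡ true → E q u ≡ true → ⊥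
    no-tri p∈ q∈ p≢q pq up qu = nt u∈ (l⊆H p∈) (l⊆H q∈) (≢-sym (u∉ p∈)) (≢-sym (u∉ q∈)) p≢q up pq qu
    lem : ∀ a b c d e f → a + (b + (c + 0)) + (d + (e + (f + 0))) ≡ a + e + (b + f) + (c + d)
    lem = solve-∀

  Link : Relation → List V → Set
  Link E l = ∃[ z ] ∃[ w ] IsLink E l z w

  -- `link-degree` summed over the links: the links already chosen absorb few of the arcs at a free
  -- vertex.
  links-degree : ∀ E H Ls {u} → NoTri E H → All (Link E) Ls →
    (∀ {y} → y ∈ concat Ls → y ∈ H) → Unique (concat Ls) →
    u ∈ H → (∀ {y} → y ∈ concat Ls → y ≢ u) →
    out E u (concat Ls) + out (flip E) u (concat Ls) ≤ length Ls * 4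
  links-degree E H [] nt [] sub uq u∈ u∉ = z≤n
  links-degree E H (l ∷ Ls) {u} nt ((_ , _ , k) ∷ ks) sub uq u∈ u∉ = begin
    out E u (l ++ concat Ls) + out (flip E) u (l ++ concat Ls)
      ≡⟨ cong₂ _+_ (∑-++ (λ y → b2n (E u y)) l (concat Ls)) (∑-++ (λ y → b2n (E y u)) l (concat Ls)) ⟩
    (out E u l + out E u (concat Ls)) + (out (flip E) u l + out (flip E) u (concat Ls))
      ≡⟨ lem (out E u l) _ (out (flip E) u l) _ ⟩
    (out E u l + out (flip E) u l) + (out E u (concat Ls) + out (flip E) u (concat Ls))
      ≤⟨ +-mono-≤ (link-degree E H nt k (λ y∈ → sub (∈-++⁺ˡ y∈)) (unique-++ˡ l uq) u∈ (λ y∈ → u∉ (∈-++⁺ˡ y∈)))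
           (links-degree E H Ls nt ks (λ y∈ → sub (∈-++⁺ʳ l y∈)) (unique-++ʳ l uq) u∈ (λ y∈ → u∉ (∈-++⁺ʳ l y∈))) ⟩
    4 + length Ls * 4 ∎
    where
    open ≤-Reasoning
    lem : ∀ a b c d → a + b + (c + d) ≡ a + c + (b + d)
    lem = solve-∀

  -- Finding a further link in `Y`, outside the vertex set `X` of the chosen links, with excess `r`.

  module Remainder (E : Relation) (E-refl : ∀ v → E v v ≡ true) (Ls : List (List V)) (Y : List V)
    (uq : Unique (concat Ls ++ Y))
    (nt : NoTri E (concat Ls ++ Y)) (nq : NoQuad E (concat Ls ++ Y))
    (links : All (Link E) Ls) (r : ℕ) (1≤r : 1 ≤ r)
    where

    X = concat Ls
    H = X ++ Y
    uqY = unique-++ʳ X uq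

    inn : V → List V → ℕ
    inn = out (flip E)

    inX : ∀ {y} → y ∈ X → y ∈ H
    inX = ∈-++⁺ˡ

    inY : ∀ {y} → y ∈ Y → y ∈ H
    inY = ∈-++⁺ʳ X

    -- E is reflexive, so closed neighbourhoods are counted.
    Slack : V → V → Set
    Slack z w = out E w H + inn z H + r ≤ length X + length Y + 2

    OneWay : V → V → Set
    OneWay z w = E z w ≡ true × E w z ≡ false

    arc? : ∀ z w → Dec (OneWay z w)
    arc? z w = (E z w Bool.≟ true) ×-dec (E w z Bool.≟ false)

    split-H : ∀ u v → out E u H + inn v H ≡ (out E u X + out E u Y) + (inn v X + inn v Y)
    split-H u v = cong₂ _+_ (∑-++ (λ y → b2n (E u y)) X Y) (∑-++ (λ y → b2n (E y v)) X Y)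

    tight : ∀ {z w} → ¬ Slack z w → length X + length Y + 3 ≤ r + (out E w H + inn z H)
    tight {z} {w} ¬s = begin
      length X + length Y + 3 ≡⟨ +-suc (length X + length Y) 2 ⟩
      suc (length X + length Y + 2) ≤⟨ ≰⇒> ¬s ⟩
      out E w H + inn z H + r ≡⟨ +-comm _ r ⟩
      r + (out E w H + inn z H) ∎
      where open ≤-Reasoning

    tight-split : ∀ {z w} → ¬ Slack z w →
      length X + length Y + 3 ≤ r + ((out E w X + out E w Y) + (inn z X + inn z Y))
    tight-split {z} {w} ¬s =
      subst (λ q → length X + length Y + 3 ≤ r + q) (split-H w z) (tight ¬s)

    -- The contradiction when no link inside `Y` is slack.

    module NoSlack
      (no-arc : ∀ {z w} → z ∈ Y → w ∈ Y → E z w ≡ true → E w z ≡ false → ¬ Slack z w)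
      (no-path : ∀ {z x w} → z ∈ Y → x ∈ Y → w ∈ Y → z ≢ x → x ≢ w →
        E z x ≡ true → E x w ≡ true → E w z ≡ false → ¬ Slack z w)
      where

      -- N⁺[w] and N⁻[z] each have at most 2r - 3 vertices in `Y`, by `out-after-arc`, and are
      -- disjoint in `X`. As the arc z → w is not slack, |Y| + 9 ≤ 5r.
      asymmetric : ∀ {z w} → z ∈ Y → w ∈ Y → E z w ≡ true → E w z ≡ false → 5 * r ≤ length Y + 8 → ⊥
      asymmetric {z} {w} z∈ w∈ zw wz small =
        linear-⊥ 0 (+-mono-≤ (+-mono-≤ after before) (+-mono-≤ (+-mono-≤ (meet X inX) (tight-split t)) small))
          (lem (out E w X) (out E w Y) (inn z X) (inn z Y) (length X) (length Y) r)
        where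
        t = no-arc z∈ w∈ zw wz
        z≢w : z ≢ w
        z≢w refl = true≢false zw wz
        meet : ∀ L → (∀ {y} → y ∈ L → y ∈ H) → out E w L + inn z L ≤ length L
        meet L sub = ∑-exclusive (E w) (λ y → E y z) L λ y y∈ wy yz →
          nt (inY z∈) (inY w∈) (sub y∈) z≢w (λ { refl → true≢false wy wz }) (λ { refl → true≢false yz wz }) zw wy yz
        -- N⁺[w] and N⁻[z] are disjoint on all of `H`, so their sizes sum to at most |H|, while
        -- tightness asks for |H| + 3 - r.
        3≤r : 3 ≤ r
        3≤r = ≮⇒≥ λ lt → linear-⊥ 0 (+-mono-≤ (+-mono-≤ (meet X inX) (meet Y inY)) (+-mono-≤ (tight-split t) lt))
          (lem₃ (out E w X) (out E w Y) (inn z X) (inn z Y) (length X) (length Y) r)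
          where
          lem₃ : ∀ wX wY zX zY x y r → wX + zX + (wY + zY) + (x + y + 3 + suc r)
            ≡ suc (0 + (x + y + (r + ((wX + wY) + (zX + zY)) + 3)))
          lem₃ = solve-∀
        after : out E w Y + 3 ≤ r + r
        after = out-after-arc E X Y r uqY E-refl nt nq z∈ w∈ zw wz 3≤r λ a a∈ w≢a wa az →
          tight (no-path z∈ w∈ a∈ z≢w w≢a zw wa az)
        -- The same lemma in the reversed digraph, where `z` and `w` exchange roles and the
        -- forbidden cycles run backwards.
        before : inn z Y + 3 ≤ r + r
        before = out-after-arc (flip E) X Y r uqY E-refl
          (λ a∈ b∈ c∈ a≢b a≢c b≢c ba cb ac → nt a∈ c∈ b∈ a≢c a≢b (≢-sym b≢c) ac cb ba)
          (λ a∈ b∈ c∈ d∈ a≢b a≢c a≢d b≢c b≢d c≢d ba cb dc ad →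
            nq a∈ d∈ c∈ b∈ a≢d a≢c a≢b (≢-sym c≢d) (≢-sym b≢d) (≢-sym b≢c) ad dc cb ba)
          w∈ z∈ zw wz 3≤r λ a a∈ z≢a az wa →
            subst (λ s → length X + length Y + 3 ≤ r + s) (+-comm (out E w H) (inn a H))
              (tight (no-path a∈ z∈ w∈ (≢-sym z≢a) z≢w az zw wa))
        lem : ∀ wX wY zX zY x y r →
          wY + 3 + (zY + 3) + (wX + zX + (x + y + 3) + 5 * r)
          ≡ suc (0 + (r + r + (r + r) + (x + (r + ((wX + wY) + (zX + zY))) + (y + 8))))
        lem = solve-∀

      -- The case in which every arc inside `Y` has its reverse.

      module Symmetric (symm : ∀ {u v} → u ∈ Y → v ∈ Y → E u v ≡ true → E v u ≡ true) where

        -- `z` and `w` are the ends of a path through `x`; the inequalities record that this path is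
        -- not slack and what `out-of-centre` concludes from it.
        Centred : V → Set
        Centred x = ∃[ z ] ∃[ w ] z ∈ Y × w ∈ Y
          × (length X + length Y + 3 ≤ r + ((out E w X + out E w Y) + (inn z X + inn z Y)))
          × out E x Y ≤ r + 1 × out E w X + inn z X ≤ length X

        centred : ∀ {x} → x ∈ Y → 3 ≤ out E x Y → Centred x
        centred {x} x∈ deg = build (two-neighbours E Y uqY deg)
          where
          build : (∃[ z ] ∃[ w ] z ∈ Y × w ∈ Y × x ≢ z × x ≢ w × z ≢ w × E x z ≡ true × E x w ≡ true) → Centred x
          build (z , w , z∈ , w∈ , x≢z , x≢w , z≢w , xz , xw) =
            z , w , z∈ , w∈ , tight-split t
            , out-of-centre E X Y r uqY nt nq symm (λ y∈ → unique-split X uq y∈ x∈)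
                x∈ z∈ w∈ x≢z x≢w z≢w xz xw (tight t)
            where
            zx = symm x∈ z∈ xz
            wz : E w z ≡ false
            wz = Bool.¬-not λ wz → nt (inY x∈) (inY w∈) (inY z∈) x≢w x≢z (≢-sym z≢w) xw wz zx
            t : ¬ Slack z w
            t = no-path z∈ x∈ w∈ (≢-sym x≢z) x≢w zx xw wz

        -- A violation would make the degree at least 3, since r ≥ 1, and then `centred` yields the
        -- bound itself.
        degree-≤ : ∀ {x} → x ∈ Y → out E x Y ≤ r + 1
        degree-≤ {x} x∈ = ≮⇒≥ λ lt → <-irrefl refl (<-≤-trans lt
          (let (_ , _ , _ , _ , _ , le , _) = centred x∈ (≤-trans (s≤s (+-monoˡ-≤ 1 1≤r)) lt) in le))

        inn≤out : ∀ {x} → x ∈ Y → inn x Y ≤ out E x Y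
        inn≤out {x} x∈ = ∑-mono Y λ y y∈ → pointwise y y∈
          where
          pointwise : ∀ y → y ∈ Y → b2n (E y x) ≤ b2n (E x y)
          pointwise y y∈ with E y x in yx
          ... | false = z≤n
          ... | true rewrite symm y∈ x∈ yx = ≤-refl

        -- The ends of a path through `x` have degree at most r + 1 in `Y` and use disjoint parts of
        -- `X`, so tightness gives |Y| + 1 ≤ 3r.
        star : ∀ {x} → x ∈ Y → 3 ≤ out E x Y → 3 * r ≤ length Y → ⊥
        star {x} x∈ deg small = build (centred x∈ deg)
          where
          build : Centred x → ⊥
          build (z , w , z∈ , w∈ , t , _ , meet) = linear-⊥ 0 (+-mono-≤ (+-mono-≤ t meet)
            (+-mono-≤ (+-mono-≤ (degree-≤ w∈) (≤-trans (inn≤out z∈) (degree-≤ z∈))) small))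
            (lem (out E w X) (out E w Y) (inn z X) (inn z Y) (length X) (length Y) r)
            where
            lem : ∀ wX wY zX zY x y r →
              x + y + 3 + (wX + zX) + (wY + zY + 3 * r)
              ≡ suc (0 + (r + ((wX + wY) + (zX + zY)) + x + (r + 1 + (r + 1) + y)))
            lem = solve-∀

        Heavy : Set
        Heavy = ∀ {u v} → u ∈ Y → v ∈ Y → E u v ≡ false → length Ls * 4 + 5 ≤ out E u H + inn v H

        -- As closed degrees in `Y` are at most 2 < |Y|, some `u`, `v` are nonadjacent, in both
        -- directions by symmetry. With L = `length Ls`, `Heavy` for both orders asks for 8L + 10
        -- arcs, but `X` provides at most 8L and `Y` at most 8.
        sparse : (∀ {x} → x ∈ Y → out E x Y ≤ 2) → 3 ≤ length Y → Heavy → ⊥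
        sparse low 3≤Y heavy = apart (nonadjacent (≤-trans (s≤s z≤n) 3≤Y))
          where
          nonadjacent : 1 ≤ length Y → ∃[ u ] ∃[ v ] u ∈ Y × v ∈ Y × E u v ≡ false
          nonadjacent 1≤Y =
            let u , u∈ , _ = ∑-exceeds (λ _ → 1) (λ _ → 0) Y
                  (≤-trans (s≤s (≤-reflexive (trans (∑-const 0 Y) (*-zeroʳ (length Y)))))
                    (≤-trans 1≤Y (≤-reflexive (sym (∑-1 Y)))))
                v , v∈ , lt = ∑-exceeds (λ _ → 1) (λ y → b2n (E u y)) Y
                  (≤-<-trans (low u∈) (≤-trans 3≤Y (≤-reflexive (sym (∑-1 Y)))))
            in u , v , u∈ , v∈ , Bool.¬-not λ uv → <-irrefl refl (subst (λ b → b2n b < 1) uv lt)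
          split : ∀ u v → length Ls * 4 + 5 ≤ out E u H + inn v H →
            length Ls * 4 + 5 ≤ (out E u X + out E u Y) + (inn v X + inn v Y)
          split u v = subst (length Ls * 4 + 5 ≤_) (split-H u v)
          X-degree : ∀ {u} → u ∈ Y → out E u X + inn u X ≤ length Ls * 4
          X-degree u∈ = links-degree E H Ls nt links inX (unique-++ˡ X uq) (inY u∈) (λ y∈ → unique-split X uq y∈ u∈)
          lem : ∀ L uX uY iX iY vX vY jX jY →
            L + 5 + (L + 5) + (uX + iX + (vX + jX) + (uY + vY + (iY + jY)))
            ≡ suc (1 + ((uX + uY) + (jX + jY) + ((vX + vY) + (iX + iY)) + (L + L + (2 + 2 + (2 + 2)))))
          lem = solve-∀
          apart : (∃[ u ] ∃[ v ] u ∈ Y × v ∈ Y × E u v ≡ false) → ⊥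
          apart (u , v , u∈ , v∈ , uv) = linear-⊥ 1
            (+-mono-≤ (+-mono-≤ (split u v (heavy u∈ v∈ uv)) (split v u (heavy v∈ u∈ vu)))
              (+-mono-≤ (+-mono-≤ (X-degree u∈) (X-degree v∈))
                (+-mono-≤ (+-mono-≤ (low u∈) (low v∈))
                  (+-mono-≤ (≤-trans (inn≤out u∈) (low u∈)) (≤-trans (inn≤out v∈) (low v∈))))))
            (lem (length Ls * 4) (out E u X) (out E u Y) (inn u X) (inn u Y) (out E v X) (out E v Y) (inn v X) (inn v Y))
            where
            vu : E v u ≡ false
            vu = Bool.¬-not λ e → true≢false (symm v∈ u∈ e) uv

      -- Either some arc of `Y` has no reverse and `asymmetric` applies, or `Y` is symmetric, `star`
      -- brings all closed degrees down to 2, and `sparse` applies.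
      contra : 5 * r ≤ length Y + 8 → 3 * r ≤ length Y → 3 ≤ length Y →
        (∀ {u v} → u ∈ Y → v ∈ Y → E u v ≡ false → length Ls * 4 + 5 ≤ out E u H + inn v H) → ⊥
      contra 5r 3r 3≤Y heavy = [ some , none ]′ (search₂ OneWay arc? Y)
        where
        some : (∃[ z ] ∃[ w ] z ∈ Y × w ∈ Y × OneWay z w) → ⊥
        some (_ , _ , z∈ , w∈ , zw , wz) = asymmetric z∈ w∈ zw wz 5r
        none : (∀ {z w} → z ∈ Y → w ∈ Y → ¬ OneWay z w) → ⊥
        none ¬p = Symmetric.sparse symm (λ x∈ → ≤-pred (≰⇒> λ deg → Symmetric.star symm x∈ deg 3r)) 3≤Y heavy
          where
          symm : ∀ {u v} → u ∈ Y → v ∈ Y → E u v ≡ true → E v u ≡ true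
          symm u∈ v∈ uv = Bool.¬-not λ vu → ¬p u∈ v∈ (uv , vu)

    Found : Set
    Found = ∃[ l ] ∃[ z ] ∃[ w ] IsLink E l z w × Slack z w × ∃[ Y′ ] Y ↭ l ++ Y′

    SlackArc : V → V → Set
    SlackArc z w = OneWay z w × Slack z w

    SlackPath : V → V → V → Set
    SlackPath z x w = z ≢ x × x ≢ w × E z x ≡ true × E x w ≡ true × E w z ≡ false × Slack z w

    SlackPath? : ∀ z x w → Dec (SlackPath z x w)
    SlackPath? z x w = ¬? (z ≟ x) ×-dec ¬? (x ≟ w) ×-dec (E z x Bool.≟ true) ×-dec (E x w Bool.≟ true)
      ×-dec (E w z Bool.≟ false) ×-dec (_ ≤? _)

    find-link : 5 * r ≤ length Y + 8 → 3 * r ≤ length Y → 3 ≤ length Y →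
      (∀ {u v} → u ∈ Y → v ∈ Y → E u v ≡ false → length Ls * 4 + 5 ≤ out E u H + inn v H) → Found
    find-link 5r 3r 3≤Y heavy =
      [ from-arc , from-no-arc ]′
        (search₂ SlackArc (λ z w → arc? z w ×-dec (_ ≤? _)) Y)
      where
      from-arc : (∃[ z ] ∃[ w ] z ∈ Y × w ∈ Y × SlackArc z w) → Found
      from-arc (z , w , z∈ , w∈ , (zw , wz) , s) = z ∷ w ∷ [] , z , w , arc zw wz , s
        , split-⊆ (((λ { refl → true≢false zw wz }) ∷ []) ∷ [] ∷ []) λ { (here refl) → z∈ ; (there (here refl)) → w∈ }
      from-path : (∃[ z ] ∃[ x ] ∃[ w ] z ∈ Y × x ∈ Y × w ∈ Y × SlackPath z x w) → Found
      from-path (z , x , w , z∈ , x∈ , w∈ , z≢x , x≢w , zx , xw , wz , s) =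
        z ∷ x ∷ w ∷ [] , z , w , path zx xw wz , s
        , split-⊆ ((z≢x ∷ (λ { refl → true≢false (E-refl w) wz }) ∷ []) ∷ (x≢w ∷ []) ∷ [] ∷ [])
            λ { (here refl) → z∈ ; (there (here refl)) → x∈ ; (there (there (here refl))) → w∈ }
      from-neither : (∀ {z w} → z ∈ Y → w ∈ Y → ¬ SlackArc z w) →
        (∀ {z x w} → z ∈ Y → x ∈ Y → w ∈ Y → ¬ SlackPath z x w) → Found
      from-neither ¬p ¬q = ⊥-elim (NoSlack.contra
        (λ z∈ w∈ zw wz s → ¬p z∈ w∈ ((zw , wz) , s))
        (λ z∈ x∈ w∈ z≢x x≢w zx xw wz s → ¬q z∈ x∈ w∈ (z≢x , x≢w , zx , xw , wz , s))
        5r 3r 3≤Y heavy)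
      from-no-arc : (∀ {z w} → z ∈ Y → w ∈ Y → ¬ SlackArc z w) → Found
      from-no-arc ¬p = [ from-path , from-neither ¬p ]′ (search₃ SlackPath SlackPath? Y)

-- Averaging of an additive quantity over blocks; it selects the cycle that receives more than its
-- share of arcs from the links.
concat-exceeds : {A : Set} (F : List A → ℕ) (c : ℕ) → F [] ≡ 0 → (∀ xs ys → F (xs ++ ys) ≡ F xs + F ys) →
  ∀ xss → c * length (concat xss) < F (concat xss) → ∃[ xs ] xs ∈ xss × c * length xs < F xs
concat-exceeds F c F[] F++ [] lt = contradiction (subst (c * 0 <_) F[] lt) λ ()
concat-exceeds F c F[] F++ (xs ∷ xss) lt with c * length xs <? F xs
... | yes p = xs , here refl , p
... | no ¬p = let ys , ys∈ , q = concat-exceeds F c F[] F++ xss tail in ys , there ys∈ , q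
  where
  open ≤-Reasoning
  tail : c * length (concat xss) < F (concat xss)
  tail = ≰⇒> λ le → <-irrefl refl (≤-trans lt (begin
    F (xs ++ concat xss) ≡⟨ F++ xs (concat xss) ⟩
    F xs + F (concat xss) ≤⟨ +-mono-≤ (≮⇒≥ ¬p) le ⟩
    c * length xs + c * length (concat xss) ≡⟨ *-distribˡ-+ c (length xs) _ ⟨
    c * (length xs + length (concat xss)) ≡⟨ cong (c *_) (length-++ xs) ⟨
    c * length (xs ++ concat xss) ∎))

-- Families of short cycles and the exchange of one cycle for two.

module Packing {V : Set} (_≟_ : DecidableEquality V) (E : V → V → Bool) (E-refl : ∀ v → E v v ≡ true) where
  open Digraph _≟_
  open import Data.List.Relation.Unary.Unique.DecPropositional _≟_ using (unique?)

  inn : V → List V → ℕ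
  inn = out (flip E)

  -- Distinctness of the vertices comes from the partition of a duplicate-free vertex list in
  -- `Family`.
  data ShortCycle : List V → Set where
    tri : ∀ {a b c} → E a b ≡ true → E b c ≡ true → E c a ≡ true → ShortCycle (a ∷ b ∷ c ∷ [])
    quad : ∀ {a b c d} → E a b ≡ true → E b c ≡ true → E c d ≡ true → E d a ≡ true →
      ShortCycle (a ∷ b ∷ c ∷ d ∷ [])

  length≥3 : ∀ {C} → ShortCycle C → 3 ≤ length C
  length≥3 (tri _ _ _) = ≤-refl
  length≥3 (quad _ _ _ _) = n≤1+n 3

  length≤4 : ∀ {C} → ShortCycle C → length C ≤ 4
  length≤4 (tri _ _ _) = n≤1+n 3
  length≤4 (quad _ _ _ _) = ≤-refl

  concat≤4 : ∀ {cs} → All ShortCycle cs → length (concat cs) ≤ length cs * 4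
  concat≤4 [] = z≤n
  concat≤4 {C ∷ cs} (c ∷ all) rewrite length-++ C {concat cs} = +-mono-≤ (length≤4 c) (concat≤4 all)

  -- A single permutation expresses disjointness of the cycles, given that `U` has no repetition,
  -- and keeps track of the uncovered vertices.
  record Family (U : List V) (K : ℕ) : Set where
    constructor family
    field
      cycles : List (List V)
      count : length cycles ≡ K
      short : All ShortCycle cycles
      rest : List V
      partition : U ↭ concat cycles ++ rest

  ALink : Set
  ALink = Σ (List V) (Link E)

  spans : List ALink → List (List V)
  spans = map proj₁

  weight : List V → ALink → ℕ
  weight T (_ , z , w , _) = out E w T + inn z T

  closes : ALink → V → Bool
  closes (_ , z , w , _) c = E w c ∧ E c z

  closers : List V → ALink → ℕ
  closers T k = ∑ (λ c → b2n (closes k c)) T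

  ∧-true : ∀ {a b} → a ∧ b ≡ true → a ≡ true × b ≡ true
  ∧-true {true} {true} _ = refl , refl

  close : ∀ (k : ALink) c → closes k c ≡ true → ShortCycle (c ∷ proj₁ k)
  close (_ , z , w , arc zw _) c eq = let wc , cz = ∧-true eq in tri cz zw wc
  close (_ , z , w , path zx xw _) c eq = let wc , cz = ∧-true eq in quad cz zx xw wc

  -- A vertex of `T` contributes two arcs only if it closes the link, so the weight beyond |T|
  -- counts closing vertices.
  weight≤ : ∀ T k → weight T k ≤ closers T k + length T
  weight≤ T (l , z , w , k) = begin
    out E w T + inn z T ≡⟨ ∑-+ (λ c → b2n (E w c)) (λ c → b2n (E c z)) T ⟨
    ∑ (λ c → b2n (E w c) + b2n (E c z)) T ≤⟨ ∑-mono T (λ c _ → both (E w c) (E c z)) ⟩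
    ∑ (λ c → b2n (E w c ∧ E c z) + 1) T ≡⟨ ∑-+ (λ c → b2n (E w c ∧ E c z)) (λ _ → 1) T ⟩
    closers T (l , z , w , k) + ∑ (λ _ → 1) T ≡⟨ cong (closers T (l , z , w , k) +_) (∑-1 T) ⟩
    closers T (l , z , w , k) + length T ∎
    where
    open ≤-Reasoning
    both : ∀ a b → b2n a + b2n b ≤ b2n (a ∧ b) + 1
    both true true = ≤-refl
    both true false = ≤-refl
    both false b = b2n≤1 b

  closers≤ : ∀ T k → closers T k ≤ length T
  closers≤ T k = ≤-trans (∑-mono T (λ c _ → b2n≤1 (closes k c))) (≤-reflexive (∑-1 T))

  closer : ∀ {T k} → 0 < closers T k → ∃[ c ] c ∈ T × closes k c ≡ true
  closer {T} {k} lt with ∑-exceeds (λ c → b2n (closes k c)) (λ _ → 0) T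
    (≤-trans (s≤s (≤-reflexive (trans (∑-const 0 T) (*-zeroʳ (length T))))) lt)
  ... | c , c∈ , p with closes k c in eq
  ... | true = c , c∈ , eq
  ... | false = contradiction p λ ()

  another-closer : ∀ {T k} c → Unique T → 1 < closers T k → ∃[ d ] d ∈ T × c ≢ d × closes k d ≡ true
  another-closer {T} {k} c u lt with ∑-exceeds (λ c → b2n (closes k c)) (δ c) T (≤-<-trans (∑δ≤1 c u) lt)
  ... | d , d∈ , p with δ<⇒ p
  ... | c≢d , eq = d , d∈ , c≢d , eq

  -- The sum exceeds the number of terms, so some term is at least 2; that term is at most `N`, so
  -- the others are not all zero.
  two-rich : ∀ {A : Set} (g : A → ℕ) N xs → (∀ x → g x ≤ N) → length xs ≤ N → N < ∑ g xs →
    ∃[ x ] ∃[ y ] ∃[ ys ] xs ↭ x ∷ y ∷ ys × 1 < g x × 0 < g y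
  two-rich g N xs g≤ len lt =
    let x , x∈ , 1<gx = ∑-exceeds g (λ _ → 1) xs (≤-<-trans (≤-trans (≤-reflexive (∑-1 xs)) len) lt)
        xs′ , p = split-∈ x∈
        y , y∈ , 0<gy = ∑-exceeds g (λ _ → 0) xs′
          (≤-trans (s≤s (≤-reflexive (trans (∑-const 0 xs′) (*-zeroʳ (length xs′))))) (≰⇒> (other x xs′ p)))
        ys , q = split-∈ y∈
    in x , y , ys , ↭-trans p (↭-prep x q) , 1<gx , 0<gy
    where
    other : ∀ x xs′ → xs ↭ x ∷ xs′ → ¬ ∑ g xs′ ≤ 0
    other x xs′ p le = <-irrefl refl (≤-trans lt
      (≤-trans (≤-reflexive (∑-↭ g p)) (≤-trans (+-mono-≤ (g≤ x) le) (≤-reflexive (+-identityʳ N)))))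

  weights-++ : ∀ ks xs ys → ∑ (weight (xs ++ ys)) ks ≡ ∑ (weight xs) ks + ∑ (weight ys) ks
  weights-++ [] xs ys = refl
  weights-++ (k@(_ , z , w , _) ∷ ks) xs ys
    rewrite weights-++ ks xs ys | ∑-++ (λ y → b2n (E w y)) xs ys | ∑-++ (λ y → b2n (E y z)) xs ys =
      lem (out E w xs) (out E w ys) (inn z xs) (inn z ys) _ _
    where
    lem : ∀ a b c d e f → a + b + (c + d) + (e + f) ≡ a + c + e + (b + d + f)
    lem = solve-∀

  weights-[] : ∀ ks → ∑ (weight []) ks ≡ 0
  weights-[] [] = refl
  weights-[] (k ∷ ks) = weights-[] ks

  open CommutativeMonoidSolver (++-commutativeMonoid {A = V}) using (_⊕_; _⊜_) renaming (solve to solve↭)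

  -- C is replaced by the cycles that c and d close with the links i and j.
  swap-in : ∀ {U cs ks Y C cs′ i j ks′ c d} → All ShortCycle cs → U ↭ concat cs ++ (concat (spans ks) ++ Y) →
    cs ↭ C ∷ cs′ → ks ↭ i ∷ j ∷ ks′ →
    c ∈ C → d ∈ C → d ≢ c → closes i c ≡ true → closes j d ≡ true →
    Family U (suc (length cs))
  swap-in {U} {cs} {ks} {Y} {C} {cs′} {i} {j} {ks′} {c} {d} short part p q c∈ d∈ d≢c ic jd =
    family ((c ∷ proj₁ i) ∷ (d ∷ proj₁ j) ∷ cs′) (cong suc (sym (↭-length p)))
      (close i c ic ∷ close j d jd ∷ All.tail (All-resp-↭ p short)) (C′ ++ (concat (spans ks′) ++ Y))
      (begin
        U ↭⟨ part ⟩
        concat cs ++ (concat (spans ks) ++ Y)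
          ↭⟨ ++⁺ (concat-↭ p) (++⁺ʳ Y (concat-↭ (map⁺ proj₁ q))) ⟩
        (C ++ concat cs′) ++ ((proj₁ i ++ (proj₁ j ++ concat (spans ks′))) ++ Y)
          ↭⟨ ++⁺ʳ _ (++⁺ʳ (concat cs′) (proj₂ extracted)) ⟩
        (((c ∷ []) ++ ((d ∷ []) ++ C′)) ++ concat cs′) ++ ((proj₁ i ++ (proj₁ j ++ concat (spans ks′))) ++ Y)
          ↭⟨ solve↭ 8 (λ c d C′ D I J W Y →
               ((c ⊕ (d ⊕ C′)) ⊕ D) ⊕ ((I ⊕ (J ⊕ W)) ⊕ Y) ⊜
               ((c ⊕ I) ⊕ ((d ⊕ J) ⊕ D)) ⊕ (C′ ⊕ (W ⊕ Y))) ↭-refl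
               (c ∷ []) (d ∷ []) C′ (concat cs′) (proj₁ i) (proj₁ j) (concat (spans ks′)) Y ⟩
        ((c ∷ proj₁ i) ++ ((d ∷ proj₁ j) ++ concat cs′)) ++ (C′ ++ (concat (spans ks′) ++ Y)) ∎)
    where
    open PermutationReasoning
    extracted : ∃[ C′ ] C ↭ c ∷ d ∷ C′
    extracted = split-⊆ ((≢-sym d≢c ∷ []) ∷ [] ∷ []) λ { (here refl) → c∈ ; (there (here refl)) → d∈ }
    C′ = proj₁ extracted

  -- With t links, averaging gives a cycle C of weight above (t + 1)|C|, hence with more than |C|
  -- closings. As t ≤ 3 ≤ |C|, `two-rich` supplies two links for `swap-in`.
  exchange : ∀ {U} cs ks Y → Unique U → All ShortCycle cs → U ↭ concat cs ++ (concat (spans ks) ++ Y) →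
    length ks ≤ 3 → suc (length ks) * length (concat cs) < ∑ (weight (concat cs)) ks →
    Family U (suc (length cs))
  exchange {U} cs ks Y uU short part k≤3 heavy =
    let C , C∈ , rich = concat-exceeds (λ T → ∑ (weight T) ks) (suc (length ks)) (weights-[] ks) (weights-++ ks) cs heavy
        cs′ , p = split-∈ C∈
        uC = unique-++ˡ C (unique-++ˡ (C ++ concat cs′) (Unique-resp-↭ (↭-trans part (++⁺ʳ _ (concat-↭ p))) uU))
        i , j , ks′ , q , 1<i , 0<j =
          two-rich (closers C) (length C) ks (closers≤ C)
            (≤-trans k≤3 (length≥3 (All.head (All-resp-↭ p short)))) (many C rich)
        -- `j` may have a single closing vertex, so it chooses first; `i` has two and can avoid that
        -- choice.
        d , d∈ , jd = closer {C} {j} 0<j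
        c , c∈ , d≢c , ic = another-closer {C} {i} d uC 1<i
    in swap-in {cs = cs} {ks = ks} {i = i} {j = j} short part p q c∈ d∈ d≢c ic jd
    where
    open ≤-Reasoning
    many : ∀ C → suc (length ks) * length C < ∑ (weight C) ks → length C < ∑ (closers C) ks
    many C rich = ≰⇒> λ le → <-irrefl refl (≤-trans rich (begin
      ∑ (weight C) ks ≤⟨ ∑-mono ks (λ k _ → weight≤ C k) ⟩
      ∑ (λ k → closers C k + length C) ks ≡⟨ ∑-+ (closers C) (λ _ → length C) ks ⟩
      ∑ (closers C) ks + ∑ (λ _ → length C) ks ≤⟨ +-mono-≤ le (≤-reflexive (∑-const (length C) ks)) ⟩
      length C + length ks * length C ∎))

  -- Enlarging a family by one cycle.

  module Step (U : List V) (uU : Unique U)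
    (ore : ∀ {u v} → E u v ≡ false → length U + 2 ≤ out E u U + inn v U)
    {cs : List (List V)} {R : List V} (short : All ShortCycle cs) (part : U ↭ concat cs ++ R)
    where

    S : List V
    S = concat cs

    -- Since w → z is missing, `ore` gives the pair degree sum at least |U| + 2; slackness caps the
    -- part inside the remainder, and the rest falls on `S`.
    link-weight : ∀ {z w} X Y r → R ↭ X ++ Y → E w z ≡ false →
      out E w (X ++ Y) + inn z (X ++ Y) + r ≤ length X + length Y + 2 → length S + r ≤ out E w S + inn z S
    link-weight {z} {w} X Y r p wz slack = ≮⇒≥ λ lt → linear-⊥ 0 (+-mono-≤ (+-mono-≤ total slack) lt)
      (lem (out E w S) (out E w (X ++ Y)) (inn z S) (inn z (X ++ Y)) (length S) (length X) (length Y) r)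
      where
      expand : ∀ f → ∑ f U ≡ ∑ f S + ∑ f (X ++ Y)
      expand f = trans (∑-↭ f part) (trans (∑-++ f S R) (cong (∑ f S +_) (∑-↭ f p)))
      size : length U ≡ length S + (length X + length Y)
      size = trans (↭-length part) (trans (length-++ S) (cong (length S +_) (trans (↭-length p) (length-++ X))))
      total : length S + (length X + length Y) + 2 ≤ out E w S + out E w (X ++ Y) + (inn z S + inn z (X ++ Y))
      total = subst₂ _≤_ (cong (_+ 2) size) (cong₂ _+_ (expand _) (expand _)) (ore wz)
      lem : ∀ oS oH iS iH s x y r → s + (x + y) + 2 + (oH + iH + r) + suc (oS + iS)
        ≡ suc (0 + (oS + oH + (iS + iH) + (x + y + 2) + (s + r)))
      lem = solve-∀

    -- At most 2|S| of the degree sum is spent on `S`.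
    ore-rest : ∀ {u v} X Y L → R ↭ X ++ Y → 2 * length S + 4 * L + 3 ≤ length U → E u v ≡ false →
      L * 4 + 5 ≤ out E u (X ++ Y) + inn v (X ++ Y)
    ore-rest {u} {v} X Y L p big uv = ≮⇒≥ λ lt → linear-⊥ 0
      (+-mono-≤ (+-mono-≤ (≤-trans big (m≤m+n _ 0)) total) (+-mono-≤ lt (+-mono-≤ (∑≤length (λ y → E u y) S) (∑≤length (λ y → E y v) S))))
      (lem (out E u S) (out E u (X ++ Y)) (inn v S) (inn v (X ++ Y)) (length S) (length U) L)
      where
      ∑≤length : ∀ (p : V → Bool) T → ∑ (λ y → b2n (p y)) T ≤ length T
      ∑≤length p T = ≤-trans (∑-mono T (λ y _ → b2n≤1 (p y))) (≤-reflexive (∑-1 T))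
      expand : ∀ f → ∑ f U ≡ ∑ f S + ∑ f (X ++ Y)
      expand f = trans (∑-↭ f part) (trans (∑-++ f S R) (cong (∑ f S +_) (∑-↭ f p)))
      total : length U + 2 ≤ out E u S + out E u (X ++ Y) + (inn v S + inn v (X ++ Y))
      total = subst (length U + 2 ≤_) (cong₂ _+_ (expand _) (expand _)) (ore uv)
      lem : ∀ oS oH iS iH s n L →
        2 * s + 4 * L + 3 + (n + 2) + (suc (oH + iH) + (oS + iS))
        ≡ suc (0 + (n + 0 + (oS + oH + (iS + iH)) + (L * 4 + 5 + (s + s))))
      lem = solve-∀

    Tri : V → V → V → Set
    Tri a b c = Unique (a ∷ b ∷ c ∷ []) × E a b ≡ true × E b c ≡ true × E c a ≡ true

    Quad : V → V → V → V → Set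
    Quad a b c d = Unique (a ∷ b ∷ c ∷ d ∷ []) × E a b ≡ true × E b c ≡ true × E c d ≡ true × E d a ≡ true

    extend : ∀ {C} → ShortCycle C → ∃[ R′ ] R ↭ C ++ R′ → Family U (suc (length cs))
    extend {C} shortC (R′ , p) = family (C ∷ cs) refl (shortC ∷ short) R′ (begin
      U ↭⟨ part ⟩
      concat cs ++ R ↭⟨ ++⁺ˡ (concat cs) p ⟩
      concat cs ++ (C ++ R′) ↭⟨ solve↭ 3 (λ s c r → s ⊕ (c ⊕ r) ⊜ (c ⊕ s) ⊕ r) ↭-refl (concat cs) C R′ ⟩
      (C ++ concat cs) ++ R′ ∎)
      where open PermutationReasoning

    module Free (nt : NoTri E R) (nq : NoQuad E R) where

      Extended : List ALink → List V → ℕ → Set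
      Extended ks Y r = ∃[ k ] ∃[ Y′ ] R ↭ concat (spans (k ∷ ks)) ++ Y′
        × length Y ≤ length Y′ + 3 × length S + r ≤ weight S k

      -- `find-link` is applied with the chosen links as `X`, and `link-weight` turns slack into
      -- arcs to `S`. A link has at most three vertices, whence the bound on the loss in `Y`.
      add-link : ∀ ks Y r → R ↭ concat (spans ks) ++ Y → 1 ≤ r →
        5 * r ≤ length Y + 8 → 3 * r ≤ length Y → 3 ≤ length Y →
        2 * length S + 4 * length ks + 3 ≤ length U → Extended ks Y r
      add-link ks Y r p 1≤r 5r 3r 3≤Y big = attach (Remainder.find-link E E-refl (spans ks) Y
          (Unique-resp-↭ p (unique-++ʳ S (Unique-resp-↭ part uU)))
          (λ a∈ b∈ c∈ → nt (back a∈) (back b∈) (back c∈))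
          (λ a∈ b∈ c∈ d∈ → nq (back a∈) (back b∈) (back c∈) (back d∈))
          (links ks) r 1≤r 5r 3r 3≤Y
          λ {u} {v} _ _ uv → subst (λ L → L * 4 + 5 ≤ out E u H + inn v H) (sym (length-map proj₁ ks))
            (ore-rest X Y (length ks) p big uv))
        where
        X = concat (spans ks)
        H = X ++ Y
        back : ∀ {v} → v ∈ H → v ∈ R
        back = ∈-resp-↭ (↭-sym p)
        links : ∀ ks → All (Link E) (spans ks)
        links [] = []
        links (k ∷ ks) = proj₂ k ∷ links ks
        missing : ∀ {l z w} → IsLink E l z w → E w z ≡ false
        missing (arc _ wz) = wz
        missing (path _ _ wz) = wz
        short-link : ∀ {l z w} → IsLink E l z w → length l ≤ 3
        short-link (arc _ _) = n≤1+n 2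
        short-link (path _ _ _) = ≤-refl
        attach : (∃[ l ] ∃[ z ] ∃[ w ] IsLink E l z w
          × out E w H + inn z H + r ≤ length X + length Y + 2 × ∃[ Y′ ] Y ↭ l ++ Y′) → Extended ks Y r
        attach (l , z , w , k , slack , Y′ , q) = (l , z , w , k) , Y′
          , ↭-trans p (↭-trans (++⁺ˡ X q) (solve↭ 3 (λ x l y → x ⊕ (l ⊕ y) ⊜ (l ⊕ x) ⊕ y) ↭-refl X l Y′))
          , (begin
              length Y ≡⟨ trans (↭-length q) (length-++ l) ⟩
              length l + length Y′ ≤⟨ +-monoˡ-≤ (length Y′) (short-link k) ⟩
              3 + length Y′ ≡⟨ +-comm 3 _ ⟩
              length Y′ + 3 ∎)
          , link-weight X Y r p (missing k) slack
          where open ≤-Reasoning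

      s≤4K : length S ≤ length cs * 4
      s≤4K = concat≤4 short

      size : length U ≡ length S + length R
      size = trans (↭-length part) (length-++ S)

      finish : ∀ ks Y → R ↭ concat (spans ks) ++ Y → length ks ≤ 3 →
        suc (length ks) * length S < ∑ (weight S) ks → Family U (suc (length cs))
      finish ks Y p = exchange cs ks Y uU short (↭-trans part (++⁺ˡ S p))

      -- Here `S` is empty, yet a link with excess 1 would send an arc to it; so the hypotheses
      -- handed to `finish` are contradictory.
      no-cycles : length cs ≡ 0 → 3 ≤ length U → Family U (suc (length cs))
      no-cycles K≡0 big =
        let k , Y , p , _ , wk = add-link [] R 1 ↭-refl ≤-refl (≤-trans (s≤s (s≤s (s≤s (s≤s (s≤s z≤n))))) (m≤n+m 8 _)) R≥3 R≥3
              (subst (λ s → 2 * s + 4 * 0 + 3 ≤ length U) (sym S≡0) big)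
        in finish (k ∷ []) Y p (s≤s z≤n) (≤-trans
             (≤-reflexive (subst (λ s → suc (2 * s) ≡ s + 1) (sym S≡0) refl)) (≤-trans wk (m≤m+n _ 0)))
        where
        S≡0 : length S ≡ 0
        S≡0 = n≤0⇒n≡0 (subst (λ K → length S ≤ K * 4) K≡0 s≤4K)
        R≥3 : 3 ≤ length R
        R≥3 = subst (3 ≤_) (trans size (cong (_+ length R) S≡0)) big

      -- With |S| ≤ 4 and |R| ≥ 11 there is room for links of excess 3 and then 2, of total weight
      -- 2|S| + 5 > 3|S|.
      one-cycle : length cs ≡ 1 → 15 ≤ length U → Family U (suc (length cs))
      one-cycle K≡1 big =
        let k₁ , Y₁ , p₁ , R≤ , w₁ = add-link [] R 3 ↭-refl (s≤s z≤n)
              (≤-trans (m≤n+m 15 4) (+-monoˡ-≤ 8 R≥11)) (≤-trans (m≤n+m 9 2) R≥11) (≤-trans (m≤n+m 3 8) R≥11)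
              (room 0 z≤n)
            Y≥8 = +-cancelʳ-≤ 3 8 (length Y₁) (≤-trans R≥11 R≤)
            k₂ , Y₂ , p₂ , _ , w₂ = add-link (k₁ ∷ []) Y₁ 2 p₁ (s≤s z≤n)
              (≤-trans (m≤n+m 10 6) (+-monoˡ-≤ 8 Y≥8)) (≤-trans (m≤n+m 6 2) Y≥8) (≤-trans (m≤n+m 3 5) Y≥8)
              (room 1 ≤-refl)
        in finish (k₂ ∷ k₁ ∷ []) Y₂ p₂ (n≤1+n 2) (≮⇒≥ λ lt → linear-⊥ 0
             (+-mono-≤ (+-mono-≤ w₁ w₂) (+-mono-≤ lt S≤4)) (lem (length S) (weight S k₁) (weight S k₂)))
        where
        S≤4 : length S ≤ 4
        S≤4 = subst (λ K → length S ≤ K * 4) K≡1 s≤4K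
        R≥11 : 11 ≤ length R
        R≥11 = +-cancelˡ-≤ 4 11 (length R) (≤-trans big (≤-trans (≤-reflexive size) (+-monoˡ-≤ (length R) S≤4)))
        room : ∀ L → L ≤ 1 → 2 * length S + 4 * L + 3 ≤ length U
        room L L≤1 = ≤-trans (+-monoˡ-≤ 3 (+-mono-≤ (*-monoʳ-≤ 2 S≤4) (*-monoʳ-≤ 4 L≤1))) big
        lem : ∀ s a b → s + 3 + (s + 2) + (suc (b + (a + 0)) + s) ≡ suc (0 + (a + b + (suc (3 * s) + 4)))
        lem = solve-∀

      -- Three links of excess `r` have total weight at least 3s + 3r, which exceeds 4s by `3r>s`.
      many-cycles : 2 ≤ length cs → 12 * length cs + 3 ≤ length U → Family U (suc (length cs))
      many-cycles K≥2 big =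
        let k₁ , Y₁ , p₁ , R≤ , w₁ = add-link [] R r ↭-refl 1≤r
              (≤-trans 5r (+-monoʳ-≤ h 2≤8)) (≤-trans (m≤m+n _ 6) 3r+6) (≤-trans (m≤n+m 3 16) R≥19) (room 0 z≤n)
            k₂ , Y₂ , p₂ , Y₁≤ , w₂ = add-link (k₁ ∷ []) Y₁ r p₁ 1≤r
              (below₁ (length Y₁) R≤) (below₂ (length Y₁) R≤)
              (below₃ (length Y₁) R≤) (room 1 (s≤s z≤n))
            k₃ , Y₃ , p₃ , _ , w₃ = add-link (k₂ ∷ k₁ ∷ []) Y₂ r p₂ 1≤r
              (below₄ (length Y₁) (length Y₂) R≤ Y₁≤) (below₅ (length Y₁) (length Y₂) R≤ Y₁≤)
              (below₆ (length Y₁) (length Y₂) R≤ Y₁≤) (room 2 ≤-refl)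
        in finish (k₃ ∷ k₂ ∷ k₁ ∷ []) Y₃ p₃ ≤-refl (≮⇒≥ λ lt → linear-⊥ 0
             (+-mono-≤ (+-mono-≤ (+-mono-≤ w₁ w₂) w₃) (+-mono-≤ lt 3r>s))
             (lem (length S) (weight S k₁) (weight S k₂) (weight S k₃) r))
        where
        K = length cs
        h = length R
        s = length S
        -- The largest excess with 5r ≤ |Y| + 8 for all three links: two earlier ones may use six
        -- vertices, leaving |Y| ≥ h - 6.
        r = (h + 2) / 5
        2≤8 : 2 ≤ 8
        2≤8 = m≤n+m 2 6
        5r : 5 * r ≤ h + 2
        5r = ≤-trans (≤-reflexive (*-comm 5 r)) (m/n*n≤m (h + 2) 5)
        h+2< : h + 2 ≤ 4 + 5 * r
        h+2< = ≤-trans (≤-reflexive (m≡m%n+[m/n]*n (h + 2) 5))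
          (+-mono-≤ (≤-pred (m%n<n (h + 2) 5)) (≤-reflexive (*-comm r 5)))
        big′ : 12 * K + 3 ≤ s + h
        big′ = ≤-trans big (≤-reflexive size)
        R≥19 : 19 ≤ h
        R≥19 = ≮⇒≥ λ lt → linear-⊥ 0 (+-mono-≤ (+-mono-≤ big′ s≤4K) (+-mono-≤ lt (*-monoʳ-≤ 8 K≥2))) (eq K s h)
          where
          eq : ∀ K s h → 12 * K + 3 + s + (suc h + 8 * 2) ≡ suc (0 + (s + h + K * 4 + (19 + 8 * K)))
          eq = solve-∀
        1≤r : 1 ≤ r
        1≤r = ≮⇒≥ λ lt → linear-⊥ 16 (+-mono-≤ (+-mono-≤ R≥19 h+2<) (*-monoʳ-≤ 5 lt)) (eq h r)
          where
          eq : ∀ h r → 19 + (h + 2) + 5 * suc r ≡ suc (16 + (h + (4 + 5 * r) + 5 * 1))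
          eq = solve-∀
        -- The 6 again allows for the vertices of two earlier links.
        3r+6 : 3 * r + 6 ≤ h
        3r+6 = ≮⇒≥ λ lt → linear-⊥ 6 (+-mono-≤ (+-mono-≤ R≥19 R≥19) (+-mono-≤ (*-monoʳ-≤ 5 lt) (*-monoʳ-≤ 3 5r))) (eq h r)
          where
          eq : ∀ h r → 19 + 19 + (5 * suc h + 3 * (5 * r)) ≡ suc (6 + (h + h + (5 * (3 * r + 6) + 3 * (h + 2))))
          eq = solve-∀
        -- From 5r ≥ h - 2 and h ≥ 12K + 3 - s follows 15r ≥ 36K + 3 - 3s, which is above 5s because
        -- s ≤ 4K.
        3r>s : s < 3 * r
        3r>s = ≮⇒≥ λ lt → linear-⊥ 10
          (+-mono-≤ (+-mono-≤ (*-monoʳ-≤ 5 lt) (*-monoʳ-≤ 3 h+2<)) (+-mono-≤ (*-monoʳ-≤ 3 big′) (+-mono-≤ (*-monoʳ-≤ 8 s≤4K) (*-monoʳ-≤ 4 K≥2)))) (eq K s h r)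
          where
          eq : ∀ K s h r → 5 * suc (3 * r) + 3 * (h + 2) + (3 * (12 * K + 3) + (8 * s + 4 * 2))
            ≡ suc (10 + (5 * suc s + 3 * (4 + 5 * r) + (3 * (s + h) + (8 * (K * 4) + 4 * K))))
          eq = solve-∀
        -- Uses s ≤ 4K and L ≤ 2 ≤ K: the left side is at most 12K + 3.
        room : ∀ L → L ≤ 2 → 2 * s + 4 * L + 3 ≤ length U
        room L L≤2 = ≮⇒≥ λ lt → linear-⊥ 0 (+-mono-≤ (+-mono-≤ lt big) (+-mono-≤ (*-monoʳ-≤ 2 s≤4K) (*-monoʳ-≤ 4 (≤-trans L≤2 K≥2))))
          (eq K s L (length U))
          where
          eq : ∀ K s L n → suc n + (12 * K + 3) + (2 * s + 4 * L) ≡ suc (0 + (2 * s + 4 * L + 3 + n + (2 * (K * 4) + 4 * K)))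
          eq = solve-∀
        lem : ∀ s a b c r → s + r + (s + r) + (s + r) + (suc (c + (b + (a + 0))) + suc s)
          ≡ suc (0 + (a + b + c + (suc (4 * s) + 3 * r)))
        lem = solve-∀
        below₂ : ∀ y → h ≤ y + 3 → 3 * r ≤ y
        below₂ y le = +-cancelʳ-≤ 3 (3 * r) y (≤-trans (+-monoʳ-≤ (3 * r) (m≤n+m 3 3)) (≤-trans 3r+6 le))
        below₁ : ∀ y → h ≤ y + 3 → 5 * r ≤ y + 8
        below₁ y le = ≤-trans 5r (≤-trans (+-monoˡ-≤ 2 le) (≤-trans (≤-reflexive (+-assoc y 3 2)) (+-monoʳ-≤ y (m≤n+m 5 3))))
        below₃ : ∀ y → h ≤ y + 3 → 3 ≤ y
        below₃ y le = +-cancelʳ-≤ 3 3 y (≤-trans (m≤n+m 6 13) (≤-trans R≥19 le))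
        twice : ∀ y y′ → h ≤ y + 3 → y ≤ y′ + 3 → h ≤ y′ + 6
        twice y y′ le le′ = ≤-trans le (≤-trans (+-monoˡ-≤ 3 le′) (≤-reflexive (+-assoc y′ 3 3)))
        below₄ : ∀ y y′ → h ≤ y + 3 → y ≤ y′ + 3 → 5 * r ≤ y′ + 8
        below₄ y y′ le le′ = ≤-trans 5r (≤-trans (+-monoˡ-≤ 2 (twice y y′ le le′)) (≤-reflexive (+-assoc y′ 6 2)))
        below₅ : ∀ y y′ → h ≤ y + 3 → y ≤ y′ + 3 → 3 * r ≤ y′
        below₅ y y′ le le′ = +-cancelʳ-≤ 6 (3 * r) y′ (≤-trans 3r+6 (twice y y′ le le′))
        below₆ : ∀ y y′ → h ≤ y + 3 → y ≤ y′ + 3 → 3 ≤ y′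
        below₆ y y′ le le′ = +-cancelʳ-≤ 6 3 y′ (≤-trans (m≤n+m 9 10) (≤-trans R≥19 (twice y y′ le le′)))

      another : ∀ K → length cs ≡ K → 12 * K + 3 ≤ length U → Family U (suc (length cs))
      another 0 eq big = no-cycles eq big
      another 1 eq big = one-cycle eq big
      another (suc (suc K)) eq big = many-cycles (subst (2 ≤_) (sym eq) (s≤s (s≤s z≤n)))
        (subst (λ K → 12 * K + 3 ≤ length U) (sym eq) big)

    -- A short cycle inside `R` is simply added to the family; if there is none, `Free` applies.
    step : 12 * length cs + 3 ≤ length U → Family U (suc (length cs))
    step big = [ from-tri , from-no-tri ]′ (search₃ Tri tri? R)
      where
      tri? : ∀ a b c → Dec (Tri a b c)
      tri? a b c = unique? (a ∷ b ∷ c ∷ [])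
        ×-dec (_ Bool.≟ _) ×-dec (_ Bool.≟ _) ×-dec (_ Bool.≟ _)
      quad? : ∀ a b c d → Dec (Quad a b c d)
      quad? a b c d = unique? (a ∷ b ∷ c ∷ d ∷ [])
        ×-dec (_ Bool.≟ _) ×-dec (_ Bool.≟ _) ×-dec (_ Bool.≟ _) ×-dec (_ Bool.≟ _)
      from-tri : (∃[ a ] ∃[ b ] ∃[ c ] a ∈ R × b ∈ R × c ∈ R × Tri a b c) → Family U (suc (length cs))
      from-tri (a , b , c , a∈ , b∈ , c∈ , u , ab , bc , ca) = extend (tri ab bc ca)
        (split-⊆ u λ { (here refl) → a∈ ; (there (here refl)) → b∈ ; (there (there (here refl))) → c∈ })
      from-quad : (∃[ a ] ∃[ b ] ∃[ c ] ∃[ d ] a ∈ R × b ∈ R × c ∈ R × d ∈ R × Quad a b c d) → Family U (suc (length cs))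
      from-quad (a , b , c , d , a∈ , b∈ , c∈ , d∈ , u , ab , bc , cd , da) = extend (quad ab bc cd da)
        (split-⊆ u λ { (here refl) → a∈ ; (there (here refl)) → b∈ ; (there (there (here refl))) → c∈
                     ; (there (there (there (here refl)))) → d∈ })
      from-neither : (∀ {a b c} → a ∈ R → b ∈ R → c ∈ R → ¬ Tri a b c) →
        (∀ {a b c d} → a ∈ R → b ∈ R → c ∈ R → d ∈ R → ¬ Quad a b c d) → Family U (suc (length cs))
      from-neither ¬tri ¬quad = Free.another
        (λ a∈ b∈ c∈ a≢b a≢c b≢c ab bc ca →
          ¬tri a∈ b∈ c∈ ((a≢b ∷ a≢c ∷ []) ∷ (b≢c ∷ []) ∷ [] ∷ [] , ab , bc , ca))
        (λ a∈ b∈ c∈ d∈ a≢b a≢c a≢d b≢c b≢d c≢d ab bc cd da →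
          ¬quad a∈ b∈ c∈ d∈ ((a≢b ∷ a≢c ∷ a≢d ∷ []) ∷ (b≢c ∷ b≢d ∷ []) ∷ (c≢d ∷ []) ∷ [] ∷ [] , ab , bc , cd , da))
        (length cs) refl big
      from-no-tri : (∀ {a b c} → a ∈ R → b ∈ R → c ∈ R → ¬ Tri a b c) → Family U (suc (length cs))
      from-no-tri ¬tri = [ from-quad , from-neither ¬tri ]′ (search₄ Quad quad? R)

  pack : ∀ (U : List V) → Unique U → (∀ {u v} → E u v ≡ false → length U + 2 ≤ out E u U + inn v U) →
    ∀ k → 12 * k ≤ length U + 9 → Family U k
  pack U uU ore zero big = family [] refl [] U ↭-refl
  pack U uU ore (suc k) big = grow (pack U uU ore k (≤-trans (*-monoʳ-≤ 12 (n≤1+n k)) big))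
    where
    -- The size hypothesis for `suc k` cycles, rewritten for enlarging a family of `k`.
    big′ : 12 * k + 3 ≤ length U
    big′ = +-cancelʳ-≤ 9 _ _ (≤-trans (≤-reflexive (trans (+-assoc (12 * k) 3 9)
      (trans (+-comm (12 * k) 12) (sym (*-suc 12 k))))) big)
    grow : Family U k → Family U (suc k)
    grow (family cs refl short R part) = Step.step U uU ore short part big′

-- Blocks of a duplicate-free concatenation.

lookup-injective : {A : Set} (xs : List A) → Unique xs → ∀ i j → lookup xs i ≡ lookup xs j → i ≡ j
lookup-injective (x ∷ xs) u zero zero eq = refl
lookup-injective (x ∷ xs) (d ∷ u) zero (suc j) eq = ⊥-elim (All.lookup d (∈-lookup j) eq)
lookup-injective (x ∷ xs) (d ∷ u) (suc i) zero eq = ⊥-elim (All.lookup d (∈-lookup i) (sym eq))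
lookup-injective (x ∷ xs) (d ∷ u) (suc i) (suc j) eq = cong suc (lookup-injective xs u i j eq)

∈-concat : {A : Set} {x : A} (xss : List (List A)) (i : Fin (length xss)) → x ∈ lookup xss i → x ∈ concat xss
∈-concat (xs ∷ xss) zero x∈ = ∈-++⁺ˡ x∈
∈-concat (xs ∷ xss) (suc i) x∈ = ∈-++⁺ʳ xs (∈-concat xss i x∈)

unique-block : {A : Set} (xss : List (List A)) → Unique (concat xss) → ∀ i → Unique (lookup xss i)
unique-block (xs ∷ xss) u zero = unique-++ˡ xs u
unique-block (xs ∷ xss) u (suc i) = unique-block xss (unique-++ʳ xs u) i

same-block : {A : Set} {x : A} (xss : List (List A)) → Unique (concat xss) →
  ∀ i j → x ∈ lookup xss i → x ∈ lookup xss j → i ≡ j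
same-block (xs ∷ xss) u zero zero _ _ = refl
same-block (xs ∷ xss) u zero (suc j) p q = ⊥-elim (unique-split xs u p (∈-concat xss j q) refl)
same-block (xs ∷ xss) u (suc i) zero p q = ⊥-elim (unique-split xs u q (∈-concat xss i p) refl)
same-block (xs ∷ xss) u (suc i) (suc j) p q = cong suc (same-block xss (unique-++ʳ xs u) i j p q)

-- Contracting the perfect matching and lifting cycles back.

module Contraction {n : ℕ} (G M : BipGraph n) (pm : IsPerfectMatching G M) where

  M⊆G = proj₁ pm

  μ : Fin n → Fin n
  μ x = proj₁ (proj₁ (proj₂ pm) x)

  μ-edge : ∀ x → M x (μ x) ≡ true
  μ-edge x = proj₁ (proj₂ (proj₁ (proj₂ pm) x))

  partner-unique : ∀ {a b y} → M a y ≡ true → M b y ≡ true → a ≡ b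
  partner-unique {y = y} ay by =
    let _ , _ , uniq = proj₂ (proj₂ pm) y in trans (uniq _ ay) (sym (uniq _ by))

  μ-injective : ∀ {a b} → μ a ≡ μ b → a ≡ b
  μ-injective {a} {b} eq = partner-unique (μ-edge a) (subst (λ y → M b y ≡ true) (sym eq) (μ-edge b))

  -- The matching edges become loops.
  E : Fin n → Fin n → Bool
  E u v = G v (μ u)

  E-refl : ∀ v → E v v ≡ true
  E-refl v = M⊆G v (μ v) (μ-edge v)

  open Digraph {Fin n} Fin._≟_ using (out)
  open Packing {Fin n} Fin._≟_ E E-refl

  -- The images under the injective `μ` form a duplicate-free list of full length, so nothing is
  -- left over. Sums over Y thereby become sums over X.
  reindex : allFin n ↭ map μ (allFin n)
  reindex with split-⊆ (Unique.map⁺ μ-injective (Unique.allFin⁺ n)) (λ {y} _ → ∈-allFin y)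
  ... | [] , p = ↭-trans p (↭-reflexive (++-identityʳ _))
  ... | z ∷ zs , p = contradiction (trans (↭-length p) (length-++ (map μ (allFin n)))) (λ eq →
    linear-⊥ (length zs) (≤-reflexive (sym eq)) (trans (cong (_+ suc (length zs)) (length-map μ (allFin n)))
      (lem (length (allFin n)) (length zs))))
    where
    lem : ∀ a b → a + suc b ≡ suc (b + a)
    lem = solve-∀

  degX≡inn : ∀ v → degX G v ≡ inn v (allFin n)
  degX≡inn v = trans (∑-↭ (λ y → b2n (G v y)) reindex) (cong sum (sym (map-∘ (allFin n))))

  -- A missing arc u → v is a nonadjacent pair `v`, `μ u` of `G`; the degree of `μ u` is by
  -- definition the closed out-degree of `u`.
  ore : σ₁₁≥ G (n + 2) → ∀ {u v} → E u v ≡ false →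
    length (allFin n) + 2 ≤ out E u (allFin n) + inn v (allFin n)
  ore σ {u} {v} uv = begin
    length (allFin n) + 2 ≡⟨ cong (_+ 2) (length-tabulate _) ⟩
    n + 2 ≤⟨ σ v (μ u) uv ⟩
    degX G v + degY G (μ u) ≡⟨ cong (_+ degY G (μ u)) (degX≡inn v) ⟩
    inn v (allFin n) + degY G (μ u) ≡⟨ +-comm (inn v (allFin n)) _ ⟩
    out E u (allFin n) + inn v (allFin n) ∎
    where open ≤-Reasoning

  -- Each vertex of the directed cycle is expanded into its matching edge, and the arcs supply the
  -- remaining edges.
  lift : ∀ m → m ≡ 2 ⊎ m ≡ 3 → (f : Fin (suc m) → Fin n) → Injective f →
    (∀ i → E (f i) (f (next i)) ≡ true) → (∀ i → next i ≢ i) → MCycle68 G M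
  lift m m68 f inj edge moves = record
    { half = m
    ; half68 = m68
    ; cyc = record
      { xs = f
      ; ys = λ i → μ (f i)
      ; xs-inj = inj
      ; ys-inj = λ i j eq → inj i j (μ-injective eq)
      ; edge₁ = λ i → E-refl (f i)
      ; edge₂ = edge
      }
    ; isM = trans (cong sum (map-cong one (allFin (suc m)))) (trans (∑-1 (allFin (suc m))) (length-tabulate {n = suc m} id))
    }
    where
    -- The edge coming from an arc is outside `M`, since `μ (f i)` has the unique partner `f i` and
    -- `next i` differs from `i`.
    one : ∀ i → b2n (M (f i) (μ (f i))) + b2n (M (f (next i)) (μ (f i))) ≡ 1
    one i rewrite μ-edge (f i) | Bool.¬-not {M (f (next i)) (μ (f i))} {true}
      (λ e → moves i (inj _ _ (partner-unique e (μ-edge (f i))))) = refl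

  -- Recording that each y is the partner of its x lets disjointness in Y follow from disjointness
  -- in X.
  OnCycle : List (Fin n) → MCycle68 G M → Set
  OnCycle C c = ∀ i → xs (cyc c) i ∈ C × ys (cyc c) i ≡ μ (xs (cyc c) i)

  realise : ∀ {C} → Unique C → ShortCycle C → Σ (MCycle68 G M) (OnCycle C)
  realise {C} u (tri ab bc ca) = lift 2 (inj₁ refl) (lookup C) (lookup-injective C u)
    (λ { zero → ab ; (suc zero) → bc ; (suc (suc zero)) → ca })
    (λ { zero () ; (suc zero) () ; (suc (suc zero)) () }) , λ i → ∈-lookup i , refl
  realise {C} u (quad ab bc cd da) = lift 3 (inj₂ refl) (lookup C) (lookup-injective C u)
    (λ { zero → ab ; (suc zero) → bc ; (suc (suc zero)) → cd ; (suc (suc (suc zero))) → da })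
    (λ { zero () ; (suc zero) () ; (suc (suc zero)) () ; (suc (suc (suc zero))) () }) , λ i → ∈-lookup i , refl

  realise-all : ∀ {k} → Family (allFin n) k →
    Σ (Fin k → MCycle68 G M) λ C → (i j : Fin k) → i ≢ j → Disjoint (cyc (C i)) (cyc (C j))
  realise-all (family cs refl short R part) = (λ i → proj₁ (cycle i)) , λ i j i≢j →
    (λ a b eq → apart i j i≢j a b eq)
    , λ a b eq → apart i j i≢j a b (μ-injective
        (trans (sym (proj₂ (proj₂ (cycle i) a))) (trans eq (proj₂ (proj₂ (cycle j) b)))))
    where
    u : Unique (concat cs)
    u = unique-++ˡ (concat cs) (Unique-resp-↭ part (Unique.allFin⁺ n))
    cycle : ∀ i → Σ (MCycle68 G M) (OnCycle (lookup cs i))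
    cycle i = realise (unique-block cs u i) (All.lookup short (∈-lookup i))
    apart : ∀ i j → i ≢ j → ∀ a b → xs (cyc (proj₁ (cycle i))) a ≢ xs (cyc (proj₁ (cycle j))) b
    apart i j i≢j a b eq = i≢j (same-block cs u i j (proj₁ (proj₂ (cycle i) a))
      (subst (_∈ lookup cs j) (sym eq) (proj₁ (proj₂ (cycle j) b))))

theorem3 : (k n : ℕ) → 1 ≤ k → 12 * k ≤ n + 9
    → (G : BipGraph n) → (M : Fin n → Fin n → Bool) → IsPerfectMatching G M
    → σ₁₁≥ G (n + 2)
    → Σ (Fin k → MCycle68 G M) λ C →
    (i j : Fin k) → i ≢ j → Disjoint (cyc (C i)) (cyc (C j))
theorem3 k n _ big G M pm σ = realise-all (pack (allFin n) (Unique.allFin⁺ n) (ore σ) k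
  (subst (λ N → 12 * k ≤ N + 9) (sym (length-tabulate id)) big))
  where
  open Contraction G M pm
  open Packing {Fin n} Fin._≟_ E E-refl using (pack)
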